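{- There does not exist a distance-regular graph with intersection array $\{80, 54, 12; 1, 6, 60\}$.
   Context: All graphs are finite, undirected and simple. A connected graph $\Gamma$ of diameter $D$ is distance-regular with intersection array $\{b_0,b_1,\ldots,b_{D-1};c_1,c_2,\ldots,c_D\}$ if for every $i\in\{0,\ldots,D\}$ and every pair of vertices $x,y$ at distance $i$, the number of neighbors of $y$ at distance $i-1$ from $x$ equals $c_i$ and the number of neighbors of $y$ at distance $i+1$ from $x$ equals $b_i$ (with $c_0=b_D=0$); both numbers depend only on $i$. -}

module Defs where

open import Level using (0ℓ)
open import Data.Nat using (ℕ; zero; suc; _≤_; _<_)
open import Data.Nat.Properties using (allUpTo?)
open import Data.Fin using (Fin; toℕ)
open import Data.Fin.Properties using (any?; _≟_)
open import Data.Product using (_×_; ∃; ∃-syntax)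
open import Data.Vec using (Vec; lookup; count; allFin)
open import Relation.Binary.Core using (Rel)
open import Relation.Binary.Definitions using (Decidable; Symmetric)
open import Relation.Binary.PropositionalEquality using (_≡_)
open import Relation.Nullary using (¬_; Dec)
open import Relation.Nullary.Decidable using (_×-dec_; ¬?)

-- Adjacency is decidable so that neighbours can be counted.
record Graph (n : ℕ) : Set₁ where
  field
    Adj    : Rel (Fin n) 0ℓ
    adj?   : Decidable Adj
    sym    : Symmetric Adj
    irrefl : ∀ x → ¬ Adj x x

module _ {n : ℕ} (G : Graph n) where
  open Graph G

  Walk : ℕ → Fin n → Fin n → Set
  Walk zero    x y = x ≡ y
  Walk (suc k) x y = ∃[ z ] (Adj x z × Walk k z y)

  walk? : ∀ k x y → Dec (Walk k x y)
  walk? zero    x y = x ≟ y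
  walk? (suc k) x y = any? (λ z → adj? x z ×-dec walk? k z y)

  Connected : Set
  Connected = ∀ x y → ∃[ k ] Walk k x y

  -- Distance as a relation: Dist k x y says that d(x , y) = k.
  Dist : ℕ → Fin n → Fin n → Set
  Dist k x y = Walk k x y × (∀ {j} → j < k → ¬ Walk j x y)

  dist? : ∀ k x y → Dec (Dist k x y)
  dist? k x y = walk? k x y ×-dec allUpTo? (λ j → ¬? (walk? j x y)) k

  -- A graph without vertices has no diameter.
  HasDiameter : ℕ → Set
  HasDiameter D =
    (∀ x y → ∃[ k ] (k ≤ D × Dist k x y)) × (∃[ x ] ∃[ y ] Dist D x y)

  -- The number of neighbours of y at distance k from x.
  neighboursAt : ℕ → Fin n → Fin n → ℕ
  neighboursAt k x y = count (λ z → adj? y z ×-dec dist? k x z) (allFin n)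

  -- The vectors are b = (b₀ , … , b_{D-1}) and c = (c₁ , … , c_D), so that
  -- lookup c i is c_{i+1}.  The remaining conditions c₀ = b_D = 0 hold
  -- automatically: no vertex is at distance -1 or D + 1 from another.
  record IsDistanceRegular {D : ℕ} (b c : Vec ℕ D) : Set where
    field
      connected : Connected
      diameter  : HasDiameter D
      b-number  : ∀ (i : Fin D) x y → Dist (toℕ i) x y →
                  neighboursAt (suc (toℕ i)) x y ≡ lookup b i
      c-number  : ∀ (i : Fin D) x y → Dist (suc (toℕ i)) x y →
                  neighboursAt (toℕ i) x y ≡ lookup c i

-- The local graph at x has 80 vertices and valency 25, and two of its vertices that are not
-- adjacent have at most 5 common neighbours in it. A vertex with 6 neighbours in a clique is
-- therefore adjacent to the whole clique.
--
-- Suppose that v₀, …, v₄ are pairwise nonadjacent in the local graph. Counting shows that every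
-- vertex is equal or adjacent to one or two of the v's and that any two v's have exactly 5 common
-- neighbours. Call the pair ij dominated if one of these 5 is adjacent to everything that the other
-- three v's miss. If no pair inside ijk were dominated, double counting the edges between the three
-- sets of common neighbours would give 2 (x + y + z) = 75; and dominating vertices have too large
-- degree if many pairs are dominated. No graph of dominated pairs meets both requirements.
--
-- Hence the local graph has no 5-coclique. The vertices adjacent to only one member of a 4-coclique
-- form four cliques, and these grow to cliques covering the local graph. A clique of the
-- distance-regular graph has at most 21 vertices, by a Delsarte type bound that compares the
-- number t of neighbours in it with 3 and the number r of its vertices at distance 3 with 6. So the
-- local graph splits into four 20-cliques: each edge lies on a line, a clique of size 21, and by
-- equality in the bound a vertex off a line has 0 or 3 neighbours on it. Now let x be off a line L
-- with 3 neighbours on L. The lines joining x to these each contain 3 neighbours of any other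
-- y ∈ L, so x and y have 9 > 6 common neighbours.

module Submission where

open import Defs
open import Data.Bool using (Bool; true; false; T; _∧_; _∨_; _xor_; not; if_then_else_)
open import Data.Bool.Properties using (∧-comm; ∧-idem; ∧-zeroʳ; ∨-zeroʳ; ¬-not) renaming (_≟_ to _≟ᵇ_)
open import Data.Empty using (⊥; ⊥-elim)
open import Data.Fin using (Fin; zero; suc)
open import Data.Fin.Patterns
open import Data.Fin.Properties using (all?; any?; ¬∀⟶∃¬; _≟_)
open import Data.Nat using (ℕ; zero; suc; _+_; _*_; _≤_; _<_; z≤n; s≤s; s≤s⁻¹; _∸_; _≤ᵇ_; _≤?_)
open import Data.Nat.Properties hiding (_≟_)
open import Data.Nat.Solver using (module +-*-Solver)
open import Data.Product using (Σ-syntax; ∃-syntax; _×_; _,_; proj₁; proj₂)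
open import Data.Sum using (_⊎_; inj₁; inj₂)
open import Data.Unit using (tt)
open import Data.Vec using (Vec; []; _∷_; head; tail; lookup; count; allFin; tabulate)
open import Function using (_∘_)
open import Relation.Binary.PropositionalEquality
open import Relation.Nullary using (¬_; Dec; yes; no; does; contradiction)
open import Relation.Nullary.Decidable using (dec-true; dec-false; from-no; from-yes; map′; _→-dec_; _×-dec_; ¬?)
open import Algebra.Properties.Semiring.Sum +-*-semiring
  using (sum; sum-cong-≗; ∑-distrib-+; ∑-comm; *-distribˡ-sum; *-distribʳ-sum)

private variable
  n k l m : ℕ

-- Booleans

_⇒_ : Bool → Bool → Bool
true  ⇒ b = b
false ⇒ _ = true

infixr 4 _⇒_

⇒-intro : ∀ {a b} → (a ≡ true → b ≡ true) → (a ⇒ b) ≡ true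
⇒-intro {true}  f = f refl
⇒-intro {false} f = refl

⇒-elim : ∀ {a b} → (a ⇒ b) ≡ true → a ≡ true → b ≡ true
⇒-elim p refl = p

⇒-false : ∀ {a b} → (a ⇒ b) ≡ false → a ≡ true × b ≡ false
⇒-false {true} p = refl , p

∧-intro : ∀ {a b} → a ≡ true → b ≡ true → a ∧ b ≡ true
∧-intro refl refl = refl

∧-elim : ∀ {a b} → a ∧ b ≡ true → a ≡ true × b ≡ true
∧-elim {true} p = refl , p

not-intro : ∀ {a} → a ≡ false → not a ≡ true
not-intro refl = refl

not-elim : ∀ {a} → not a ≡ true → a ≡ false
not-elim {false} _ = refl

∨-false : ∀ {a b} → a ∨ b ≡ false → a ≡ false × b ≡ false
∨-false {false} p = refl , p

∨-elim : ∀ {a b} → a ∨ b ≡ true → a ≡ true ⊎ b ≡ true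
∨-elim {true}  _ = inj₁ refl
∨-elim {false} h = inj₂ h

clash : ∀ {a} {A : Set} → a ≡ true → a ≡ false → A
clash refl ()

⇔-≡ : ∀ {a b} → (a ≡ true → b ≡ true) → (b ≡ true → a ≡ true) → a ≡ b
⇔-≡ {true}          f g = sym (f refl)
⇔-≡ {false} {false} f g = refl
⇔-≡ {false} {true}  f g = g refl

-- Counting

Pred : ℕ → Set
Pred n = Fin n → Bool

⟦_⟧ : Bool → ℕ
⟦ true  ⟧ = 1
⟦ false ⟧ = 0

sum-mono : (f g : Fin n → ℕ) → (∀ i → f i ≤ g i) → sum f ≤ sum g
sum-mono {zero}  f g f≤g = z≤n
sum-mono {suc n} f g f≤g = +-mono-≤ (f≤g zero) (sum-mono (f ∘ suc) (g ∘ suc) (f≤g ∘ suc))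

⟦⟧-mono : ∀ {a b} → (a ≡ true → b ≡ true) → ⟦ a ⟧ ≤ ⟦ b ⟧
⟦⟧-mono {true}  f rewrite f refl = ≤-refl
⟦⟧-mono {false} f = z≤n

opaque
  -- Opaque, so that a count stays an atom inside the comparisons below.
  # : Pred n → ℕ
  # p = sum (λ i → ⟦ p i ⟧)

  #-sum : (p : Pred n) → # p ≡ sum (λ i → ⟦ p i ⟧)
  #-sum p = refl

  #-cong : {p q : Pred n} → (∀ i → p i ≡ q i) → # p ≡ # q
  #-cong p≗q = sum-cong-≗ (λ i → cong ⟦_⟧ (p≗q i))

  #-mono : {p q : Pred n} → (∀ i → p i ≡ true → q i ≡ true) → # p ≤ # q
  #-mono p⊆q = sum-mono _ _ (λ i → ⟦⟧-mono (p⊆q i))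

  member : (p : Pred n) → 1 ≤ # p → ∃[ i ] p i ≡ true
  member {suc n} p h with p zero in eq
  ... | true  = zero , eq
  ... | false with i , pi ← member (p ∘ suc) h = suc i , pi

  #-positive : (p : Pred n) (i : Fin n) → p i ≡ true → 1 ≤ # p
  #-positive p zero    pi rewrite pi = s≤s z≤n
  #-positive p (suc i) pi = ≤-trans (#-positive (p ∘ suc) i pi) (m≤n+m _ ⟦ p zero ⟧)

does-true : {A : Set} (a? : Dec A) → does a? ≡ true → A
does-true (yes a) _ = a

does-false : {A : Set} (a? : Dec A) → does a? ≡ false → ¬ A
does-false (no ¬a) _ = ¬a

opaque
  ∀ᵇ : Pred n → Bool
  ∀ᵇ p = does (all? λ i → p i ≟ᵇ true)

  ∀ᵇ-intro : {p : Pred n} → (∀ i → p i ≡ true) → ∀ᵇ p ≡ true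
  ∀ᵇ-intro {p = p} = dec-true (all? λ i → p i ≟ᵇ true)

  ∀ᵇ-elim : {p : Pred n} → ∀ᵇ p ≡ true → ∀ i → p i ≡ true
  ∀ᵇ-elim {p = p} = does-true (all? λ i → p i ≟ᵇ true)

  ∀ᵇ-false : {p : Pred n} → ∀ᵇ p ≡ false → ∃[ i ] p i ≡ false
  ∀ᵇ-false {p = p} e =
    let i , ¬pi = ¬∀⟶∃¬ _ _ (λ i → p i ≟ᵇ true) (does-false (all? λ i → p i ≟ᵇ true) e)
    in i , ¬-not ¬pi

-- Double counting

∑⟨_⟩ : Pred n → (Fin n → ℕ) → ℕ
∑⟨ p ⟩ f = sum (λ i → ⟦ p i ⟧ * f i)

∑⟨⟩-cong : (p : Pred n) {f g : Fin n → ℕ} → (∀ i → p i ≡ true → f i ≡ g i) → ∑⟨ p ⟩ f ≡ ∑⟨ p ⟩ g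
∑⟨⟩-cong p f≗g = sum-cong-≗ pointwise
  where
  pointwise : ∀ i → ⟦ p i ⟧ * _ ≡ ⟦ p i ⟧ * _
  pointwise i with p i | f≗g i
  ... | true  | h = cong (1 *_) (h refl)
  ... | false | _ = refl

∑⟨⟩-const : (p : Pred n) (a : ℕ) → ∑⟨ p ⟩ (λ _ → a) ≡ # p * a
∑⟨⟩-const p a = sym (trans (cong (_* a) (#-sum p)) (*-distribʳ-sum a (⟦_⟧ ∘ p)))

∑⟨⟩-distrib-+ : (p : Pred n) (f g : Fin n → ℕ) → ∑⟨ p ⟩ (λ i → f i + g i) ≡ ∑⟨ p ⟩ f + ∑⟨ p ⟩ g
∑⟨⟩-distrib-+ p f g =
  trans (sum-cong-≗ (λ i → *-distribˡ-+ ⟦ p i ⟧ (f i) (g i)))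
        (∑-distrib-+ (λ i → ⟦ p i ⟧ * f i) (λ i → ⟦ p i ⟧ * g i))

double-count : (r : Fin m → Fin n → Bool) (p : Pred m) (q : Pred n) →
               ∑⟨ p ⟩ (λ i → # (λ j → r i j ∧ q j)) ≡ ∑⟨ q ⟩ (λ j → # (λ i → r i j ∧ p i))
double-count r p q = begin
  ∑⟨ p ⟩ (λ i → # (λ j → r i j ∧ q j))                ≡⟨ sum-cong-≗ (λ i → expand (p i) (λ j → r i j ∧ q j)) ⟩
  sum (λ i → sum (λ j → ⟦ p i ⟧ * ⟦ r i j ∧ q j ⟧))  ≡⟨ ∑-comm (λ i j → ⟦ p i ⟧ * ⟦ r i j ∧ q j ⟧) ⟩
  sum (λ j → sum (λ i → ⟦ p i ⟧ * ⟦ r i j ∧ q j ⟧))  ≡⟨ sum-cong-≗ (λ j → sum-cong-≗ (λ i → swap (p i) (r i j) (q j))) ⟩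
  sum (λ j → sum (λ i → ⟦ q j ⟧ * ⟦ r i j ∧ p i ⟧))  ≡⟨ sum-cong-≗ (λ j → sym (expand (q j) (λ i → r i j ∧ p i))) ⟩
  ∑⟨ q ⟩ (λ j → # (λ i → r i j ∧ p i))                ∎
  where
  open ≡-Reasoning
  expand : ∀ {n} (b : Bool) (s : Pred n) → ⟦ b ⟧ * # s ≡ sum (λ j → ⟦ b ⟧ * ⟦ s j ⟧)
  expand b s = trans (cong (⟦ b ⟧ *_) (#-sum s)) (*-distribˡ-sum ⟦ b ⟧ (⟦_⟧ ∘ s))
  swap : ∀ a b d → ⟦ a ⟧ * ⟦ b ∧ d ⟧ ≡ ⟦ d ⟧ * ⟦ b ∧ a ⟧
  swap false b     true  = sym (cong (1 *_) (cong ⟦_⟧ (∧-zeroʳ b)))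
  swap false b     false = refl
  swap true  true  true  = refl
  swap true  true  false = refl
  swap true  false true  = refl
  swap true  false false = refl

-- Comparing counts by truth tables

valid : ∀ k → (Vec Bool k → Bool) → Bool
valid zero    f = f []
valid (suc k) f = valid k (f ∘ (true ∷_)) ∧ valid k (f ∘ (false ∷_))

valid-sound : ∀ k (f : Vec Bool k → Bool) → valid k f ≡ true → ∀ v → f v ≡ true
valid-sound zero    f h []          = h
valid-sound (suc k) f h (true ∷ v)  = valid-sound k _ (proj₁ (∧-elim h)) v
valid-sound (suc k) f h (false ∷ v) = valid-sound k _ (proj₂ (∧-elim {valid k (f ∘ (true ∷_))} h)) v

trues : Vec Bool k → ℕ
trues []       = 0
trues (b ∷ bs) = ⟦ b ⟧ + trues bs

at : Vec (Pred n) k → Fin n → Vec Bool k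
at []       w = []
at (p ∷ ps) w = p w ∷ at ps w

infixr 5 _∷_

-- One bound for each column of `F`. The index is their sum, nested to the right and ending in `0`,
-- which is where the final `+ 0` in later inequalities comes from.
data Lower : (Fin n → Vec Bool l) → ℕ → Set where
  []  : {F : Fin n → Vec Bool 0} → Lower F 0
  _∷_ : {F : Fin n → Vec Bool (suc l)} {a s : ℕ} →
        a ≤ # (head ∘ F) → Lower (tail ∘ F) s → Lower F (a + s)

data Upper : (Fin n → Vec Bool l) → ℕ → Set where
  []  : {F : Fin n → Vec Bool 0} → Upper F 0
  _∷_ : {F : Fin n → Vec Bool (suc l)} {a s : ℕ} →
        # (head ∘ F) ≤ a → Upper (tail ∘ F) s → Upper F (a + s)

lower-sound : {F : Fin n → Vec Bool l} {s : ℕ} → Lower F s → s ≤ sum (trues ∘ F)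
lower-sound [] = z≤n
lower-sound {F = F} (a≤ ∷ r) =
  ≤-trans (+-mono-≤ (≤-trans a≤ (≤-reflexive (#-sum _))) (lower-sound r))
    (≤-reflexive (trans (sym (∑-distrib-+ (⟦_⟧ ∘ head ∘ F) (trues ∘ tail ∘ F)))
                        (sum-cong-≗ (λ i → split (F i)))))
  where
  split : ∀ {l} (v : Vec Bool (suc l)) → ⟦ head v ⟧ + trues (tail v) ≡ trues v
  split (_ ∷ _) = refl

upper-sound : {F : Fin n → Vec Bool l} {s : ℕ} → Upper F s → sum (trues ∘ F) ≤ s
upper-sound {n} {F = F} [] = ≤-trans (≤-reflexive (sum-cong-≗ (λ i → nil (F i)))) (zeros n)
  where
  nil : (v : Vec Bool 0) → trues v ≡ 0
  nil [] = refl
  zeros : ∀ n → sum {n} (λ _ → 0) ≤ 0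
  zeros zero    = z≤n
  zeros (suc n) = zeros n
upper-sound {F = F} (≤a ∷ r) =
  ≤-trans (≤-reflexive (trans (sum-cong-≗ (λ i → split (F i)))
                              (∑-distrib-+ (⟦_⟧ ∘ head ∘ F) (trues ∘ tail ∘ F))))
          (+-mono-≤ (≤-trans (≤-reflexive (sym (#-sum _))) ≤a) (upper-sound r))
  where
  split : ∀ {l} (v : Vec Bool (suc l)) → trues v ≡ ⟦ head v ⟧ + trues (tail v)
  split (_ ∷ _) = refl

≤ᵇ-complete : ∀ {a b} → a ≤ b → (a ≤ᵇ b) ≡ true
≤ᵇ-complete {a} {b} a≤b = T-true (≤⇒≤ᵇ a≤b)
  where
  T-true : ∀ {x} → T x → x ≡ true
  T-true {true} _ = refl

≤ᵇ-sound : ∀ a b → (a ≤ᵇ b) ≡ true → a ≤ b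
≤ᵇ-sound a b h = ≤ᵇ⇒≤ a b (subst (T) (sym h) tt)

-- A comparison assigns to the truth values of some predicates at a point a
-- hypothesis and two lists of predicates, the second containing at least as many
-- true ones as the first whenever the hypothesis holds.
Comparison : ℕ → ℕ → ℕ → Set
Comparison k l m = Vec Bool k → Bool × Vec Bool l × Vec Bool m

holds : Comparison k l m → Vec Bool k → Bool
holds C v with h , ls , us ← C v = h ⇒ (trues ls ≤ᵇ trues us)

-- Summing over all points a pointwise inequality that holds by truth table. All inclusion-exclusion
-- arguments below take this form: `refl` evaluates the table, and the two lists give the known
-- bounds on the counts.
compare : (ps : Vec (Pred n) k) (C : Comparison k l m) → valid k (holds C) ≡ true →
          (∀ w → proj₁ (C (at ps w)) ≡ true) → {a b : ℕ} →
          Lower (λ w → proj₁ (proj₂ (C (at ps w)))) a →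
          Upper (λ w → proj₂ (proj₂ (C (at ps w)))) b → a ≤ b
compare {k = k} ps C h hyp lo hi = ≤-trans (lower-sound lo) (≤-trans (sum-mono _ _ pointwise) (upper-sound hi))
  where
  pointwise : ∀ w → trues (proj₁ (proj₂ (C (at ps w)))) ≤ trues (proj₂ (proj₂ (C (at ps w))))
  pointwise w = ≤ᵇ-sound _ _ (⇒-elim (valid-sound k (holds C) h (at ps w)) (hyp w))

-- The neighbours of a vertex, with adjacency made reflexive on them.
record Local (n : ℕ) : Set where
  field
    W      : Pred n
    c      : Fin n → Pred n
    c-refl : ∀ {u} → W u ≡ true → c u u ≡ true
    c-sym  : ∀ u w → c u w ≡ c w u
    c-W    : ∀ {u w} → c u w ≡ true → W w ≡ true
    order  : # W ≡ 80
    degree : ∀ {u} → W u ≡ true → # (c u) ≡ 26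
    common : ∀ {u w} → W u ≡ true → W w ≡ true → c u w ≡ false →
             # (λ z → c u z ∧ c w z) ≤ 5

-- Cliques, cocliques and common neighbours in a local graph

module LocalTheory {n : ℕ} (Γ : Local n) where
  open Local Γ public

  -- As `c` is reflexive on `W`, `apart` also makes the members distinct.
  record Coclique {k : ℕ} (v : Fin k → Fin n) : Set where
    field
      inW   : ∀ i → W (v i) ≡ true
      apart : ∀ i j → i ≢ j → c (v i) (v j) ≡ false

    deg : ∀ i → # (c (v i)) ≡ 26
    deg i = degree (inW i)

    com : ∀ i j → i ≢ j → # (λ z → c (v i) z ∧ c (v j) z) ≤ 5
    com i j i≢j = common (inW i) (inW j) (apart i j i≢j)

  open Coclique public

  infixr 5 _◂_

  -- Each vertex is compared with the later ones only; `coclique` adds the rest by symmetry.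
  data Apart : {k : ℕ} → Vec (Fin n) k → Set where
    []  : Apart []
    _◂_ : ∀ {k u} {us : Vec (Fin n) k} → W u ≡ true × (∀ i → c u (lookup us i) ≡ false) →
          Apart us → Apart (u ∷ us)

  coclique : ∀ {k} {us : Vec (Fin n) k} → Apart us → Coclique (lookup us)
  coclique as = record { inW = inW′ as ; apart = apart′ as }
    where
    inW′ : ∀ {k} {us : Vec (Fin n) k} → Apart us → ∀ i → W (lookup us i) ≡ true
    inW′ (a ◂ as) zero    = proj₁ a
    inW′ (a ◂ as) (suc i) = inW′ as i
    apart′ : ∀ {k} {us : Vec (Fin n) k} → Apart us →
             ∀ i j → i ≢ j → c (lookup us i) (lookup us j) ≡ false
    apart′ (a ◂ as) zero    zero    i≢j = contradiction refl i≢j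
    apart′ (a ◂ as) zero    (suc j) i≢j = proj₂ a j
    apart′ (a ◂ as) (suc i) zero    i≢j = trans (c-sym _ _) (proj₂ a i)
    apart′ (a ◂ as) (suc i) (suc j) i≢j = apart′ as i j (i≢j ∘ cong suc)

  reindex : ∀ {k l} {v : Fin k → Fin n} → Coclique v → (σ : Fin l → Fin k) →
            (∀ i j → i ≢ j → σ i ≢ σ j) → Coclique (v ∘ σ)
  reindex V σ inj = record
    { inW   = λ i → inW V (σ i)
    ; apart = λ i j i≢j → apart V (σ i) (σ j) (inj i j i≢j) }

  Clique : Pred n → Set
  Clique A = ∀ a b → A a ≡ true → A b ≡ true → c a b ≡ true

  complete : Pred n → Pred n
  complete A w = W w ∧ ∀ᵇ (λ a → A a ⇒ c w a)

  complete-elim : ∀ A {w} → complete A w ≡ true → W w ≡ true × (∀ a → A a ≡ true → c w a ≡ true)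
  complete-elim A h = let Ww , h′ = ∧-elim h in Ww , λ a → ⇒-elim (∀ᵇ-elim h′ a)

  complete-intro : ∀ A {w} → W w ≡ true → (∀ a → A a ≡ true → c w a ≡ true) → complete A w ≡ true
  complete-intro A Ww h = ∧-intro Ww (∀ᵇ-intro λ a → ⇒-intro (h a))

  complete-false : ∀ A {w} → W w ≡ true → complete A w ≡ false → ∃[ a ] (A a ≡ true × c w a ≡ false)
  complete-false A {w} Ww h with W w | Ww
  ... | true | _ = let a , e = ∀ᵇ-false h in a , ⇒-false e

  -- A vertex and a member a of A that it is not adjacent to have the neighbours
  -- of the vertex in A in common.
  few-neighbours : ∀ (A : Pred n) {w a} → (∀ b → A b ≡ true → c a b ≡ true) → W w ≡ true → W a ≡ true →
                   c w a ≡ false → # (λ z → c w z ∧ A z) ≤ 5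
  few-neighbours A {w} {a} a~A Ww Wa w≁a =
    ≤-trans (#-mono λ z h → let wz , Az = ∧-elim h in ∧-intro wz (a~A z Az)) (common Ww Wa w≁a)

  -- If some member of the clique is missed, all neighbours in the clique are common neighbours with
  -- that member. Six neighbours in a clique therefore force adjacency to all of it.
  complete-or-few : ∀ A → Clique A → (∀ a → A a ≡ true → W a ≡ true) → ∀ {w} → W w ≡ true →
                    complete A w ≡ true ⊎ # (λ z → c w z ∧ A z) ≤ 5
  complete-or-few A cl A⊆W {w} Ww with complete A w in eq
  ... | true  = inj₁ refl
  ... | false = let a , Aa , w≁a = complete-false A Ww eq
                in inj₂ (few-neighbours A (λ b → cl a b Aa) Ww (A⊆W a Aa) w≁a)

  complete-to-six : ∀ (A : Pred n) {u w} → 6 ≤ # A → (∀ a → A a ≡ true → c u a ≡ true) →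
                    (∀ a → A a ≡ true → c w a ≡ true) →
                    W u ≡ true → W w ≡ true → c u w ≡ true
  complete-to-six A {u} {w} six u~A w~A Wu Ww with c u w in eq
  ... | true  = refl
  ... | false = contradiction
    (≤-trans six (≤-trans (#-mono λ z Az → ∧-intro (u~A z Az) (w~A z Az)) (common Wu Ww eq)))
    (from-no (6 ≤? 5))

  -- The two exempt indices may coincide: when the coclique covers `W`, `uncovered v i i` consists
  -- of the private neighbours of `v i`, including `v i` itself.
  uncovered : ∀ {k} → (Fin k → Fin n) → Fin k → Fin k → Pred n
  uncovered v i j p = W p ∧ ∀ᵇ (λ k → not (does (k ≟ i)) ⇒ not (does (k ≟ j)) ⇒ not (c (v k) p))

  Uncovered : ∀ {k} → (Fin k → Fin n) → Fin k → Fin k → Fin n → Set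
  Uncovered v i j p = W p ≡ true × (∀ k → k ≢ i → k ≢ j → c (v k) p ≡ false)

  uncovered-elim : ∀ {k} (v : Fin k → Fin n) i j {p} → uncovered v i j p ≡ true → Uncovered v i j p
  uncovered-elim v i j h = let Wp , h′ = ∧-elim h in
    Wp , λ k k≢i k≢j → not-elim (⇒-elim (⇒-elim (∀ᵇ-elim h′ k)
      (cong not (dec-false (k ≟ i) k≢i))) (cong not (dec-false (k ≟ j) k≢j)))

  uncovered-intro : ∀ {k} (v : Fin k → Fin n) i j {p} → Uncovered v i j p → uncovered v i j p ≡ true
  uncovered-intro v i j (Wp , h) = ∧-intro Wp (∀ᵇ-intro λ k →
    ⇒-intro λ k≢i → ⇒-intro λ k≢j →
      not-intro (h k (does-false (k ≟ i) (not-elim k≢i)) (does-false (k ≟ j) (not-elim k≢j))))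

  record Permutes {k : ℕ} (σ : Fin k → Fin k) : Set where
    constructor permutes
    field
      injective  : ∀ i j → i ≢ j → σ i ≢ σ j
      surjective : ∀ k → ∃[ i ] σ i ≡ k

  open Permutes public

  Uncovered-reindex : ∀ {k} {v : Fin k → Fin n} {σ : Fin k → Fin k} → Permutes σ →
    ∀ {i j p} → Uncovered v (σ i) (σ j) p → Uncovered (v ∘ σ) i j p
  Uncovered-reindex {v = v} {σ} π {i} {j} (Wp , h) =
    Wp , λ k k≢i k≢j → h (σ k) (injective π k i k≢i) (injective π k j k≢j)

  Uncovered-unreindex : ∀ {k} {v : Fin k → Fin n} {σ : Fin k → Fin k} → Permutes σ →
    ∀ {i j p} → Uncovered (v ∘ σ) i j p → Uncovered v (σ i) (σ j) p
  Uncovered-unreindex {v = v} {σ} π {p = p} (Wp , h) = Wp , λ k k≢σi k≢σj →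
    let l , σl≡k = surjective π k in
    trans (cong (λ k → c (v k) p) (sym σl≡k))
          (h l (λ l≡i → k≢σi (trans (sym σl≡k) (cong σ l≡i))) (λ l≡j → k≢σj (trans (sym σl≡k) (cong σ l≡j))))

  permutes? : ∀ {k} (σ : Fin k → Fin k) → Dec (Permutes σ)
  permutes? σ = map′ (λ (i , s) → permutes i s) (λ π → injective π , surjective π)
    (all? (λ i → all? λ j → ¬? (i ≟ j) →-dec ¬? (σ i ≟ σ j)) ×-dec all? (λ k → any? λ i → σ i ≟ k))

  swap₀ : ∀ {k} → Fin (suc k) → Fin (suc k) → Fin (suc k)
  swap₀ i k = if does (k ≟ 0F) then i else if does (k ≟ i) then 0F else k

-- Counting around a 5-coclique

module FiveCoclique {n : ℕ} (Γ : Local n) where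
  open LocalTheory Γ

  stars : (Fin 5 → Fin n) → Vec (Pred n) 5
  stars v = c (v 0F) ∷ c (v 1F) ∷ c (v 2F) ∷ c (v 3F) ∷ c (v 4F) ∷ []

  once-or-twice : Vec Bool 5 → Bool
  once-or-twice bs = (1 ≤ᵇ trues bs) ∧ (trues bs ≤ᵇ 2)

  module _ {v : Fin 5 → Fin n} (V : Coclique v) where

    within : ∀ i {w} → (c (v i) w ⇒ W w) ≡ true
    within i = ⇒-intro c-W

    degree≤ : ∀ i → # (c (v i)) ≤ 26
    degree≤ i = ≤-reflexive (deg V i)

    degree≥ : ∀ i → 26 ≤ # (c (v i))
    degree≥ i = ≤-reflexive (sym (deg V i))

    -- A Bonferroni inequality: a vertex adjacent to `t` of the five satisfies `t ≤ 1 + t(t-1)/2`,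
    -- strictly unless `t` is 1 or 2. Summing gives 5 · 26 = 130 on the left and at most 80 + 10 · 5
    -- = 130 on the right, so no vertex can be strict.
    covered : ∀ {w} → W w ≡ true → once-or-twice (at (stars v) w) ≡ true
    covered {w₀} Ww₀ with once-or-twice (at (stars v) w₀) in eq
    ... | true  = refl
    ... | false = contradiction
      (compare (W ∷ stars v)
        (λ { (w ∷ a ∷ b ∷ d ∷ e ∷ f ∷ []) →
             (a ⇒ w) ∧ (b ⇒ w) ∧ (d ⇒ w) ∧ (e ⇒ w) ∧ (f ⇒ w)
           , (w ∧ not (once-or-twice (a ∷ b ∷ d ∷ e ∷ f ∷ []))) ∷ a ∷ b ∷ d ∷ e ∷ f ∷ []
           , w ∷ (a ∧ b) ∷ (a ∧ d) ∷ (a ∧ e) ∷ (a ∧ f) ∷ (b ∧ d) ∷ (b ∧ e) ∷ (b ∧ f)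
               ∷ (d ∧ e) ∷ (d ∧ f) ∷ (e ∧ f) ∷ [] })
        refl
        (λ w → ∧-intro (within 0F) (∧-intro (within 1F) (∧-intro (within 2F) (∧-intro (within 3F) (within 4F)))))
        (#-positive _ w₀ (∧-intro Ww₀ (not-intro eq)) ∷ degree≥ 0F ∷ degree≥ 1F ∷ degree≥ 2F ∷ degree≥ 3F ∷ degree≥ 4F ∷ [])
        (≤-reflexive order ∷ com V 0F 1F (λ ()) ∷ com V 0F 2F (λ ()) ∷ com V 0F 3F (λ ()) ∷ com V 0F 4F (λ ())
          ∷ com V 1F 2F (λ ()) ∷ com V 1F 3F (λ ()) ∷ com V 1F 4F (λ ())
          ∷ com V 2F 3F (λ ()) ∷ com V 2F 4F (λ ()) ∷ com V 3F 4F (λ ()) ∷ []))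
      (from-no (131 ≤? 130))

    -- The same sum with one pair left unbounded: 5 · 26 - 80 - 9 · 5 = 5. Other pairs are reached
    -- by relabelling.
    common-exact : 5 ≤ # (λ w → c (v 0F) w ∧ c (v 1F) w)
    common-exact = +-cancelˡ-≤ 125 _ _
      (≤-trans
        (compare (W ∷ stars v)
          (λ { (w ∷ a ∷ b ∷ d ∷ e ∷ f ∷ []) →
               (a ⇒ w) ∧ (b ⇒ w) ∧ (d ⇒ w) ∧ (e ⇒ w) ∧ (f ⇒ w)
             , a ∷ b ∷ d ∷ e ∷ f ∷ []
             , w ∷ (a ∧ d) ∷ (a ∧ e) ∷ (a ∧ f) ∷ (b ∧ d) ∷ (b ∧ e) ∷ (b ∧ f)
                 ∷ (d ∧ e) ∷ (d ∧ f) ∷ (e ∧ f) ∷ (a ∧ b) ∷ [] })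
          refl
          (λ w → ∧-intro (within 0F) (∧-intro (within 1F) (∧-intro (within 2F) (∧-intro (within 3F) (within 4F)))))
          (degree≥ 0F ∷ degree≥ 1F ∷ degree≥ 2F ∷ degree≥ 3F ∷ degree≥ 4F ∷ [])
          (≤-reflexive order ∷ com V 0F 2F (λ ()) ∷ com V 0F 3F (λ ()) ∷ com V 0F 4F (λ ())
            ∷ com V 1F 2F (λ ()) ∷ com V 1F 3F (λ ()) ∷ com V 1F 4F (λ ())
            ∷ com V 2F 3F (λ ()) ∷ com V 2F 4F (λ ()) ∷ com V 3F 4F (λ ()) ∷ ≤-refl ∷ []))
        (≤-reflexive (cong (125 +_) (+-identityʳ _))))

    not-thrice : ∀ i j k {w} → i ≢ j → i ≢ k → j ≢ k →
                 c (v i) w ≡ true → c (v j) w ≡ true → c (v k) w ≡ false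
    not-thrice i j k {w} i≢j i≢k j≢k ci cj = trans (sym (look k)) (not-elim
      (⇒-elim (⇒-elim (⇒-elim (valid-sound 5 (atMostTwo i j k) (table i j k i≢j i≢k j≢k) (at (stars v) w))
        (covered (c-W ci))) (trans (look i) ci)) (trans (look j) cj)))
      where
      atMostTwo : (i j k : Fin 5) → Vec Bool 5 → Bool
      atMostTwo i j k bs = once-or-twice bs ⇒ lookup bs i ⇒ lookup bs j ⇒ not (lookup bs k)
      table : ∀ i j k → i ≢ j → i ≢ k → j ≢ k → valid 5 (atMostTwo i j k) ≡ true
      table = from-yes (all? λ i → all? λ j → all? λ k →
        ¬? (i ≟ j) →-dec ¬? (i ≟ k) →-dec ¬? (j ≟ k) →-dec valid 5 (atMostTwo i j k) ≟ᵇ true)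
      look : ∀ i → lookup (at (stars v) w) i ≡ c (v i) w
      look 0F = refl
      look 1F = refl
      look 2F = refl
      look 3F = refl
      look 4F = refl

  -- Dominated pairs

  dominates : (Fin 5 → Fin n) → Fin 5 → Fin 5 → Pred n
  dominates v i j z = c (v i) z ∧ c (v j) z ∧ complete (uncovered v i j) z

  record Dominates (v : Fin 5 → Fin n) (i j : Fin 5) (z : Fin n) : Set where
    field
      left  : c (v i) z ≡ true
      right : c (v j) z ≡ true
      all   : ∀ p → Uncovered v i j p → c z p ≡ true

  open Dominates

  dominates-elim : ∀ v i j {z} → dominates v i j z ≡ true → Dominates v i j z
  dominates-elim v i j h =
    let l , h′ = ∧-elim h
        r , h″ = ∧-elim h′
    in record { left = l ; right = r
              ; all = λ p u → proj₂ (complete-elim (uncovered v i j) h″) p (uncovered-intro v i j u) }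

  dominates-intro : ∀ v i j {z} → Dominates v i j z → dominates v i j z ≡ true
  dominates-intro v i j d = ∧-intro (left d) (∧-intro (right d)
    (complete-intro (uncovered v i j) (c-W (left d)) λ p u → all d p (uncovered-elim v i j u)))

  dominated : (Fin 5 → Fin n) → Fin 5 → Fin 5 → Bool
  dominated v i j = 1 ≤ᵇ # (dominates v i j)

  dominated-member : ∀ v i j → dominated v i j ≡ true → ∃[ z ] Dominates v i j z
  dominated-member v i j h =
    let z , d = member (dominates v i j) (≤ᵇ-sound 1 _ h) in z , dominates-elim v i j d

  not-dominated : ∀ v i j → dominated v i j ≡ false → ∀ z → dominates v i j z ≡ false
  not-dominated v i j h z with dominates v i j z in eq
  ... | false = refl
  ... | true  = clash (≤ᵇ-complete (#-positive (dominates v i j) z eq)) h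

  dominated-cong : ∀ {v v′ i j i′ j′} → (∀ z → Dominates v i j z → Dominates v′ i′ j′ z) →
                   (∀ z → Dominates v′ i′ j′ z → Dominates v i j z) →
                   dominated v i j ≡ dominated v′ i′ j′
  dominated-cong {v} {v′} {i} {j} {i′} {j′} f g = cong (1 ≤ᵇ_) (#-cong λ z →
    ⇔-≡ (dominates-intro v′ i′ j′ ∘ f z ∘ dominates-elim v i j)
        (dominates-intro v i j ∘ g z ∘ dominates-elim v′ i′ j′))

  Dominates-flip : ∀ {v i j z} → Dominates v i j z → Dominates v j i z
  Dominates-flip d = record { left = right d ; right = left d
                            ; all = λ p (Wp , h) → all d p (Wp , λ k k≢i k≢j → h k k≢j k≢i) }

  dominated-sym : ∀ v i j → dominated v i j ≡ dominated v j i
  dominated-sym v i j = dominated-cong (λ z → Dominates-flip) (λ z → Dominates-flip)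

  Dominates-reindex : ∀ {v σ} → Permutes σ → ∀ {i j z} → Dominates v (σ i) (σ j) z → Dominates (v ∘ σ) i j z
  Dominates-reindex π d = record { left = left d ; right = right d
                                 ; all = λ p u → all d p (Uncovered-unreindex π u) }

  Dominates-unreindex : ∀ {v σ} → Permutes σ → ∀ {i j z} → Dominates (v ∘ σ) i j z → Dominates v (σ i) (σ j) z
  Dominates-unreindex π d = record { left = left d ; right = right d
                                   ; all = λ p u → all d p (Uncovered-reindex π u) }

  -- Domination does not depend on the labelling, so the lemmas below can fix their indices.
  dominated-reindex : ∀ v {σ} → Permutes σ → ∀ i j → dominated (v ∘ σ) i j ≡ dominated v (σ i) (σ j)
  dominated-reindex v π i j = dominated-cong (λ z → Dominates-unreindex π) (λ z → Dominates-reindex π)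

  module _ {v : Fin 5 → Fin n} (V : Coclique v) where

    -- Otherwise y could take the place of v₂, and z would be covered three times.
    private-apart : ∀ {z y} → c (v 0F) z ≡ true → c (v 1F) z ≡ true → c (v 2F) y ≡ true →
                    (∀ k → k ≢ 2F → c (v k) y ≡ false) → c z y ≡ false
    private-apart {z} {y} c₀z c₁z c₂y y-private = trans (c-sym z y)
      (not-thrice (coclique V′) 0F 1F 2F (λ ()) (λ ()) (λ ()) c₀z c₁z)
      where
      V′ : Apart (v 0F ∷ v 1F ∷ y ∷ v 3F ∷ v 4F ∷ [])
      V′ = (inW V 0F , λ { 0F → apart V 0F 1F (λ ()) ; 1F → y-private 0F (λ ())
                         ; 2F → apart V 0F 3F (λ ()) ; 3F → apart V 0F 4F (λ ()) })
         ◂ (inW V 1F , λ { 0F → y-private 1F (λ ()) ; 1F → apart V 1F 3F (λ ()) ; 2F → apart V 1F 4F (λ ()) })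
         ◂ (c-W c₂y , λ { 0F → trans (c-sym _ _) (y-private 3F (λ ())) ; 1F → trans (c-sym _ _) (y-private 4F (λ ())) })
         ◂ (inW V 3F , λ { 0F → apart V 3F 4F (λ ()) })
         ◂ (inW V 4F , λ ()) ◂ []

    -- The vertices `z` and `p` replace v₀ and v₁: by `not-thrice`, `z` misses the other three. The
    -- order puts `z` and v₂ first, where `common-exact` applies to them.
    swap : ∀ {z p} → c (v 0F) z ≡ true → c (v 1F) z ≡ true → Uncovered v 0F 1F p → c z p ≡ false →
           Apart (z ∷ v 2F ∷ p ∷ v 3F ∷ v 4F ∷ [])
    swap {z} {p} c₀z c₁z (Wp , p-apart) z≁p =
           (c-W c₀z , λ { 0F → z≁ 2F (λ ()) (λ ()) ; 1F → z≁p ; 2F → z≁ 3F (λ ()) (λ ()) ; 3F → z≁ 4F (λ ()) (λ ()) })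
         ◂ (inW V 2F , λ { 0F → p-apart 2F (λ ()) (λ ()) ; 1F → apart V 2F 3F (λ ()) ; 2F → apart V 2F 4F (λ ()) })
         ◂ (Wp , λ { 0F → trans (c-sym _ _) (p-apart 3F (λ ()) (λ ())) ; 1F → trans (c-sym _ _) (p-apart 4F (λ ()) (λ ())) })
         ◂ (inW V 3F , λ { 0F → apart V 3F 4F (λ ()) })
         ◂ (inW V 4F , λ ()) ◂ []
      where
      z≁ : ∀ k → 0F ≢ k → 1F ≢ k → c z (v k) ≡ false
      z≁ k 0≢k 1≢k = trans (c-sym _ _) (not-thrice V 0F 1F k (λ ()) 0≢k 1≢k c₀z c₁z)

    -- Since `z` does not dominate, it misses an uncovered `p`, and `swap` gives a coclique in which
    -- `z` and v₂ have exactly 5 common neighbours. Each of these is adjacent to exactly one of v₀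
    -- and v₁.
    five-neighbours : ∀ {z} → c (v 0F) z ≡ true → c (v 1F) z ≡ true → dominates v 0F 1F z ≡ false →
                      # (λ w → c z w ∧ (c (v 0F) w ∧ c (v 2F) w)) + # (λ w → c z w ∧ (c (v 1F) w ∧ c (v 2F) w)) ≡ 5
    five-neighbours {z} c₀z c₁z undominating = ≤-antisym
      (≤-trans (≤-reflexive (cong (# _ +_) (sym (+-identityʳ (# _)))))
        (compare ps (λ { (z ∷ a ∷ b ∷ d ∷ e ∷ f ∷ []) → table z a b d e f
                       , (z ∧ (a ∧ d)) ∷ (z ∧ (b ∧ d)) ∷ []
                       , (z ∧ d) ∷ [] })
          refl hyp (≤-refl ∷ ≤-refl ∷ []) (com V′ 0F 1F (λ ()) ∷ [])))
      (≤-trans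
        (compare ps (λ { (z ∷ a ∷ b ∷ d ∷ e ∷ f ∷ []) → table z a b d e f
                       , (z ∧ d) ∷ []
                       , (z ∧ (a ∧ d)) ∷ (z ∧ (b ∧ d)) ∷ [] })
          refl hyp (common-exact V′ ∷ []) (≤-refl ∷ ≤-refl ∷ []))
        (≤-reflexive (cong (# _ +_) (+-identityʳ (# _)))))
      where
      p,p-uncovered,z≁p : ∃[ p ] (uncovered v 0F 1F p ≡ true × c z p ≡ false)
      p,p-uncovered,z≁p = complete-false (uncovered v 0F 1F) (c-W c₀z)
        (trans (sym (cong₂ (λ a b → a ∧ b ∧ complete (uncovered v 0F 1F) z) c₀z c₁z)) undominating)
      p = proj₁ p,p-uncovered,z≁p
      us = z ∷ v 2F ∷ p ∷ v 3F ∷ v 4F ∷ []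
      V′ : Coclique (lookup us)
      V′ = coclique (swap c₀z c₁z (uncovered-elim v 0F 1F (proj₁ (proj₂ p,p-uncovered,z≁p))) (proj₂ (proj₂ p,p-uncovered,z≁p)))
      ps = c z ∷ stars v
      table : (z a b d e f : Bool) → Bool
      table z a b d e f = z ∧ d ⇒ a xor b
      hyp : ∀ w → table (c z w) (c (v 0F) w) (c (v 1F) w) (c (v 2F) w) (c (v 3F) w) (c (v 4F) w) ≡ true
      hyp w = ⇒-intro λ h → let zw , c₂w = ∧-elim h in split zw c₂w
        where
        split : c z w ≡ true → c (v 2F) w ≡ true → c (v 0F) w xor c (v 1F) w ≡ true
        split zw c₂w with c (v 0F) w in e₀ | c (v 1F) w in e₁
        ... | true  | false = refl
        ... | false | true  = refl
        ... | true  | true  = clash c₂w (not-thrice V 0F 1F 2F (λ ()) (λ ()) (λ ()) e₀ e₁)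
        -- A common neighbour of `z` and v₂ off v₀ and v₁ also misses v₃ and v₄, by the coclique
        -- `V′`. It would be private to v₂, hence not adjacent to `z`.
        ... | false | false = clash zw (private-apart c₀z c₁z c₂w λ
          { 0F _ → e₀ ; 1F _ → e₁ ; 2F 2≢2 → contradiction refl 2≢2
          ; 3F _ → not-thrice V′ 0F 1F 3F (λ ()) (λ ()) (λ ()) zw c₂w
          ; 4F _ → not-thrice V′ 0F 1F 4F (λ ()) (λ ()) (λ ()) zw c₂w })

  -- Edges between sets of common neighbours

  pair : (Fin 5 → Fin n) → Fin 5 → Fin 5 → Pred n
  pair v i j w = c (v i) w ∧ c (v j) w

  edges : Pred n → Pred n → ℕ
  edges p q = ∑⟨ p ⟩ (λ z → # (λ w → c z w ∧ q w))

  edges-sym : ∀ p q → edges p q ≡ edges q p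
  edges-sym p q = trans (double-count c p q)
    (∑⟨⟩-cong q λ j _ → #-cong λ i → cong (_∧ p i) (c-sym i j))

  edges-congʳ : ∀ p {q q′} → (∀ w → q w ≡ q′ w) → edges p q ≡ edges p q′
  edges-congʳ p q≗q′ = ∑⟨⟩-cong p λ z _ → #-cong λ w → cong (c z w ∧_) (q≗q′ w)

  module _ {v : Fin 5 → Fin n} (V : Coclique v) where

    -- Each of the 5 common neighbours of v₀ and v₁ contributes 5, by `five-neighbours`.
    twenty-five-edges : dominated v 0F 1F ≡ false →
                        edges (pair v 0F 1F) (pair v 0F 2F) + edges (pair v 0F 1F) (pair v 1F 2F) ≡ 25
    twenty-five-edges h = begin
      edges P (pair v 0F 2F) + edges P (pair v 1F 2F)
        ≡⟨ sym (∑⟨⟩-distrib-+ P (λ z → # (λ w → c z w ∧ pair v 0F 2F w)) (λ z → # (λ w → c z w ∧ pair v 1F 2F w))) ⟩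
      ∑⟨ P ⟩ (λ z → # (λ w → c z w ∧ pair v 0F 2F w) + # (λ w → c z w ∧ pair v 1F 2F w))
        ≡⟨ ∑⟨⟩-cong P (λ z Pz → let c₀z , c₁z = ∧-elim Pz in
             five-neighbours V c₀z c₁z (not-dominated v 0F 1F h z)) ⟩
      ∑⟨ P ⟩ (λ _ → 5)
        ≡⟨ ∑⟨⟩-const P 5 ⟩
      # P * 5
        ≡⟨ cong (_* 5) (≤-antisym (com V 0F 1F (λ ())) (common-exact V)) ⟩
      25 ∎
      where
      open ≡-Reasoning
      P = pair v 0F 1F

  σ₀₂₁ σ₁₂₀ : Fin 5 → Fin 5
  σ₀₂₁ = lookup (0F ∷ 2F ∷ 1F ∷ 3F ∷ 4F ∷ [])
  σ₁₂₀ = lookup (1F ∷ 2F ∷ 0F ∷ 3F ∷ 4F ∷ [])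

  -- If none of the three pairs were dominated, the numbers x, y, z of adjacencies
  -- between the three sets of common neighbours would satisfy x + y = x + z = y + z = 25.
  some-dominated : ∀ {v} → Coclique v →
                   dominated v 0F 1F ∨ dominated v 0F 2F ∨ dominated v 1F 2F ≡ true
  some-dominated {v} V with dominated v 0F 1F in e₀₁ | dominated v 0F 2F in e₀₂ | dominated v 1F 2F in e₁₂
  ... | true  | _     | _     = refl
  ... | false | true  | _     = refl
  ... | false | false | true  = refl
  ... | false | false | false = ⊥-elim (odd z (trans (cong (z +_) (sym y≡z)) (trans (+-comm z y) y+z)))
    where
    π₀₂₁ : Permutes σ₀₂₁
    π₀₂₁ = from-yes (permutes? σ₀₂₁)
    π₁₂₀ : Permutes σ₁₂₀
    π₁₂₀ = from-yes (permutes? σ₁₂₀)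
    x = edges (pair v 0F 1F) (pair v 0F 2F)
    y = edges (pair v 0F 1F) (pair v 1F 2F)
    z = edges (pair v 0F 2F) (pair v 1F 2F)
    flip : ∀ i j w → pair v i j w ≡ pair v j i w
    flip i j w = ∧-comm (c (v i) w) (c (v j) w)
    x+y : x + y ≡ 25
    x+y = twenty-five-edges V e₀₁
    x+z : x + z ≡ 25
    x+z = trans (cong₂ _+_ (edges-sym (pair v 0F 1F) (pair v 0F 2F)) (edges-congʳ (pair v 0F 2F) (flip 1F 2F)))
      (twenty-five-edges (reindex V σ₀₂₁ (injective π₀₂₁)) (trans (dominated-reindex v π₀₂₁ 0F 1F) e₀₂))
    y+z : y + z ≡ 25
    y+z = trans (cong₂ _+_ (trans (edges-sym (pair v 0F 1F) (pair v 1F 2F)) (edges-congʳ (pair v 1F 2F) (flip 0F 1F)))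
                           (trans (edges-sym (pair v 0F 2F) (pair v 1F 2F)) (edges-congʳ (pair v 1F 2F) (flip 0F 2F))))
      (twenty-five-edges (reindex V σ₁₂₀ (injective π₁₂₀)) (trans (dominated-reindex v π₁₂₀ 0F 1F) e₁₂))
    y≡z : y ≡ z
    y≡z = +-cancelˡ-≡ x y z (trans x+y (sym x+z))
    odd : ∀ z → z + z ≢ 25
    odd z h with z ≤? 12
    ... | yes z≤12 = contradiction (subst (_≤ 24) h (+-mono-≤ z≤12 z≤12)) (from-no (25 ≤? 24))
    ... | no  z≰12 = contradiction (subst (26 ≤_) h (+-mono-≤ (≰⇒> z≰12) (≰⇒> z≰12))) (from-no (26 ≤? 25))

  -- The neighbourhood of a dominating vertex

  σ₂₃ σ₂₄ σ₃₄ : Fin 5 → Fin 5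
  σ₂₃ = lookup (2F ∷ 3F ∷ 0F ∷ 1F ∷ 4F ∷ [])
  σ₂₄ = lookup (2F ∷ 4F ∷ 0F ∷ 1F ∷ 3F ∷ [])
  σ₃₄ = lookup (3F ∷ 4F ∷ 0F ∷ 1F ∷ 2F ∷ [])

  -- The constraint that the coclique puts on every vertex, in or out of `W`, used as hypothesis in
  -- the truth tables.
  shape : Bool → Vec Bool 5 → Bool
  shape true  bs = once-or-twice bs
  shape false bs = trues bs ≤ᵇ 0

  module _ {v : Fin 5 → Fin n} (V : Coclique v) where

    shaped : ∀ w → shape (W w) (at (stars v) w) ≡ true
    shaped w with W w in eq
    ... | true  = covered V eq
    ... | false = trans (cong₂ _≤ᵇ_ (none (outside 0F) (outside 1F) (outside 2F) (outside 3F) (outside 4F)) refl) refl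
      where
      outside : ∀ i → c (v i) w ≡ false
      outside i with c (v i) w in e
      ... | true  = clash (c-W e) eq
      ... | false = refl
      none : ∀ {a b d e f} → a ≡ false → b ≡ false → d ≡ false → e ≡ false → f ≡ false →
             trues (a ∷ b ∷ d ∷ e ∷ f ∷ []) ≡ 0
      none refl refl refl refl refl = refl

    exact₂₃ : 5 ≤ # (pair v 2F 3F)
    exact₂₃ = common-exact (reindex V σ₂₃ (injective (from-yes (permutes? σ₂₃))))

    exact₂₄ : 5 ≤ # (pair v 2F 4F)
    exact₂₄ = common-exact (reindex V σ₂₄ (injective (from-yes (permutes? σ₂₄))))

    exact₃₄ : 5 ≤ # (pair v 3F 4F)
    exact₃₄ = common-exact (reindex V σ₃₄ (injective (from-yes (permutes? σ₃₄))))

    module _ {z : Fin n} (D : Dominates v 0F 1F z) where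

      beyond : Pred n
      beyond w = c z w ∧ (c (v 2F) w ∨ c (v 3F) w ∨ c (v 4F) w)

      region : (w z a b d e f : Bool) → Bool
      region w z a b d e f = shape w (a ∷ b ∷ d ∷ e ∷ f ∷ []) ∧ (z ⇒ w) ∧ (w ∧ not (d ∨ e ∨ f) ⇒ z)

      regional : ∀ w → region (W w) (c z w) (c (v 0F) w) (c (v 1F) w) (c (v 2F) w) (c (v 3F) w) (c (v 4F) w) ≡ true
      regional w = ∧-intro (shaped w) (∧-intro (⇒-intro c-W) (⇒-intro λ h →
        let Ww , h′ = ∧-elim h
            h₂ , h₃₄ = ∨-false (not-elim h′)
            h₃ , h₄ = ∨-false h₃₄
        in all D w (Ww , λ { 0F 0≢0 _ → contradiction refl 0≢0 ; 1F _ 1≢1 → contradiction refl 1≢1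
                           ; 2F _ _ → h₂ ; 3F _ _ → h₃ ; 4F _ _ → h₄ })))

      W∋z : W z ≡ true
      W∋z = c-W (left D)

      -- Inclusion-exclusion: `c z` and the stars of v₂, v₃, v₄ cover `W`, no vertex lies in all
      -- three stars, and each two of them share 5 vertices. Hence `# beyond` is 4 · 26 - 3 · 5 - 80
      -- = 9; this half uses that the pairs share at least 5, the next that they share at most 5.
      beyond≤9 : # beyond ≤ 9
      beyond≤9 = +-cancelˡ-≤ 95 _ _ (≤-trans (≤-reflexive (cong (95 +_) (sym (+-identityʳ (# beyond)))))
        (compare (W ∷ c z ∷ stars v)
          (λ { (w ∷ z ∷ a ∷ b ∷ d ∷ e ∷ f ∷ []) → region w z a b d e f
             , w ∷ (d ∧ e) ∷ (d ∧ f) ∷ (e ∧ f) ∷ (z ∧ (d ∨ e ∨ f)) ∷ []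
             , d ∷ e ∷ f ∷ z ∷ [] })
          refl regional
          (≤-reflexive (sym order) ∷ exact₂₃ ∷ exact₂₄ ∷ exact₃₄ ∷ ≤-refl ∷ [])
          (degree≤ V 2F ∷ degree≤ V 3F ∷ degree≤ V 4F ∷ ≤-reflexive (degree W∋z) ∷ [])))

      beyond≥9 : 9 ≤ # beyond
      beyond≥9 = +-cancelˡ-≤ 95 _ _ (≤-trans
        (compare (W ∷ c z ∷ stars v)
          (λ { (w ∷ z ∷ a ∷ b ∷ d ∷ e ∷ f ∷ []) → region w z a b d e f
             , d ∷ e ∷ f ∷ z ∷ []
             , w ∷ (d ∧ e) ∷ (d ∧ f) ∷ (e ∧ f) ∷ (z ∧ (d ∨ e ∨ f)) ∷ [] })
          refl regional
          (degree≥ V 2F ∷ degree≥ V 3F ∷ degree≥ V 4F ∷ ≤-reflexive (sym (degree W∋z)) ∷ [])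
          (≤-reflexive order ∷ com V 2F 3F (λ ()) ∷ com V 2F 4F (λ ()) ∷ com V 3F 4F (λ ()) ∷ ≤-refl ∷ []))
        (≤-reflexive (cong (95 +_) (+-identityʳ (# beyond)))))

      avoids : ∀ k → 0F ≢ k → 1F ≢ k → c z (v k) ≡ false
      avoids k 0≢k 1≢k = trans (c-sym _ _) (not-thrice V 0F 1F k (λ ()) 0≢k 1≢k (left D) (right D))

      -- A part of the star of v₂, because `z` is adjacent to everything that v₂, v₃ and v₄ miss.
      star₂ : Pred n
      star₂ w = W w ∧ not (c z w ∨ c (v 3F) w ∨ c (v 4F) w)

      star₂-elim : ∀ {w} → star₂ w ≡ true → W w ≡ true × c z w ≡ false × c (v 3F) w ≡ false × c (v 4F) w ≡ false
      star₂-elim h = let Ww , h′ = ∧-elim h ; hz , h₃₄ = ∨-false (not-elim h′) in Ww , hz , ∨-false h₃₄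

      -- Two vertices p and q of star₂ that are not adjacent would make a 5-coclique with z, v₃ and v₄,
      -- and then z would have 5 neighbours in common with each of v₃ and v₄.
      star₂-clique : Clique star₂
      star₂-clique p q hp hq with c p q in p≁q
      ... | true  = refl
      ... | false = contradiction
        (≤-trans
          (compare (c z ∷ stars v)
            (λ { (z ∷ a ∷ b ∷ d ∷ e ∷ f ∷ []) → not (z ∧ e ∧ f)
               , (z ∧ e) ∷ (z ∧ f) ∷ []
               , (z ∧ (d ∨ e ∨ f)) ∷ [] })
            refl disjoint (exact₃ ∷ exact₄ ∷ []) (≤-refl ∷ []))
          (≤-trans (≤-reflexive (+-identityʳ (# beyond))) beyond≤9))
        (from-no (10 ≤? 9))
        where
        quad : ∀ k l → k ≢ l → 0F ≢ k → 1F ≢ k → 0F ≢ l → 1F ≢ l →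
               c (v k) p ≡ false → c (v k) q ≡ false → c (v l) p ≡ false → c (v l) q ≡ false →
               Apart (z ∷ v k ∷ v l ∷ p ∷ q ∷ [])
        quad k l k≢l 0≢k 1≢k 0≢l 1≢l kp kq lp lq =
            (W∋z , λ { 0F → avoids k 0≢k 1≢k ; 1F → avoids l 0≢l 1≢l
                     ; 2F → proj₁ (proj₂ (star₂-elim hp)) ; 3F → proj₁ (proj₂ (star₂-elim hq)) })
          ◂ (inW V k , λ { 0F → apart V k l k≢l ; 1F → kp ; 2F → kq })
          ◂ (inW V l , λ { 0F → lp ; 1F → lq })
          ◂ (proj₁ (star₂-elim hp) , λ { 0F → p≁q })
          ◂ (proj₁ (star₂-elim hq) , λ ()) ◂ []
        p₃₄ = proj₂ (proj₂ (star₂-elim hp))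
        q₃₄ = proj₂ (proj₂ (star₂-elim hq))
        V₃₄ : Coclique (lookup (z ∷ v 3F ∷ v 4F ∷ p ∷ q ∷ []))
        V₃₄ = coclique (quad 3F 4F (λ ()) (λ ()) (λ ()) (λ ()) (λ ()) (proj₁ p₃₄) (proj₁ q₃₄) (proj₂ p₃₄) (proj₂ q₃₄))
        V₄₃ : Coclique (lookup (z ∷ v 4F ∷ v 3F ∷ p ∷ q ∷ []))
        V₄₃ = coclique (quad 4F 3F (λ ()) (λ ()) (λ ()) (λ ()) (λ ()) (proj₂ p₃₄) (proj₂ q₃₄) (proj₁ p₃₄) (proj₁ q₃₄))
        exact₃ : 5 ≤ # (λ w → c z w ∧ c (v 3F) w)
        exact₃ = common-exact V₃₄
        exact₄ : 5 ≤ # (λ w → c z w ∧ c (v 4F) w)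
        exact₄ = common-exact V₄₃
        disjoint : ∀ w → not (c z w ∧ c (v 3F) w ∧ c (v 4F) w) ≡ true
        disjoint w with c z w in ez | c (v 3F) w in e₃
        ... | false | _     = refl
        ... | true  | false = refl
        ... | true  | true  = not-intro (not-thrice V₃₄ 0F 1F 2F (λ ()) (λ ()) (λ ()) ez e₃)

  -- Two disjoint dominated pairs

  swap₀-permutes : ∀ (i : Fin 5) → Permutes (swap₀ i)
  swap₀-permutes = from-yes (all? λ i → permutes? (swap₀ {4} i))

  σ₃₂ : Fin 5 → Fin 5
  σ₃₂ = lookup (0F ∷ 1F ∷ 3F ∷ 2F ∷ 4F ∷ [])

  π₃₂ : Permutes σ₃₂
  π₃₂ = from-yes (permutes? σ₃₂)

  flag≤# : ∀ b {p : Pred n} → (b ≡ true → ∃[ w ] p w ≡ true) → ⟦ b ⟧ ≤ # p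
  flag≤# true  {p} h = let w , pw = h refl in #-positive p w pw
  flag≤# false     h = z≤n

  -- Of the 26 vertices in the star, at most 4 · 5 are shared with another star.
  six-private₀ : ∀ {v} → Coclique v → 6 ≤ # (uncovered v 0F 0F)
  six-private₀ {v} V = +-cancelʳ-≤ 20 6 _
    (compare (uncovered v 0F 0F ∷ W ∷ stars v)
      (λ { (p ∷ w ∷ a ∷ b ∷ d ∷ e ∷ f ∷ []) →
           shape w (a ∷ b ∷ d ∷ e ∷ f ∷ []) ∧ (w ∧ not (b ∨ d ∨ e ∨ f) ⇒ p)
         , a ∷ []
         , p ∷ (a ∧ b) ∷ (a ∧ d) ∷ (a ∧ e) ∷ (a ∧ f) ∷ [] })
      refl hyp (degree≥ V 0F ∷ [])
      (≤-refl ∷ com V 0F 1F (λ ()) ∷ com V 0F 2F (λ ()) ∷ com V 0F 3F (λ ()) ∷ com V 0F 4F (λ ()) ∷ []))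
    where
    hyp : ∀ w → shape (W w) (at (stars v) w) ∧
                (W w ∧ not (c (v 1F) w ∨ c (v 2F) w ∨ c (v 3F) w ∨ c (v 4F) w) ⇒ uncovered v 0F 0F w) ≡ true
    hyp w = ∧-intro (shaped V w) (⇒-intro λ h →
      let Ww , h′ = ∧-elim h
          h₁ , h₂₃₄ = ∨-false (not-elim h′)
          h₂ , h₃₄ = ∨-false h₂₃₄
          h₃ , h₄ = ∨-false h₃₄
      in uncovered-intro v 0F 0F (Ww , λ { 0F 0≢0 _ → contradiction refl 0≢0
                                         ; 1F _ _ → h₁ ; 2F _ _ → h₂ ; 3F _ _ → h₃ ; 4F _ _ → h₄ }))

  six-private : ∀ {v} → Coclique v → ∀ i → 6 ≤ # (uncovered v i i)
  six-private {v} V i = ≤-trans (six-private₀ (reindex V (swap₀ i) (injective π)))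
    (#-mono λ w h → uncovered-intro v i i (Uncovered-unreindex π (uncovered-elim (v ∘ swap₀ i) 0F 0F h)))
    where
    π = swap₀-permutes i

  -- Both are adjacent to all private neighbours of `v i`, of which there are at least six.
  dominators-adjacent : ∀ {v} → Coclique v → ∀ {i j l z u} → Dominates v i j z → Dominates v i l u → c z u ≡ true
  dominators-adjacent {v} V {i} Dz Du = complete-to-six (uncovered v i i) (six-private V i)
    (λ a h → all Dz a (weaken (uncovered-elim v i i h))) (λ a h → all Du a (weaken (uncovered-elim v i i h)))
    (c-W (left Dz)) (c-W (left Du))
    where
    weaken : ∀ {j p} → Uncovered v i i p → Uncovered v i j p
    weaken (Wp , h) = Wp , λ k k≢i _ → h k k≢i k≢i

  module _ {v : Fin 5 → Fin n} (V : Coclique v) {z z′ : Fin n}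
           (D : Dominates v 0F 1F z) (D′ : Dominates v 2F 3F z′) where

    -- At least 26 - 20 = 6 vertices are private to v₂. They are adjacent to `z′`, which dominates
    -- 23, and lie in `star₂`, since `private-apart` keeps them off `z`. Six neighbours in the
    -- clique `star₂` force all of it.
    star₂-complete : ∀ w → star₂ V D w ≡ true → c z′ w ≡ true
    star₂-complete w h
      with complete-or-few (star₂ V D) (star₂-clique V D) (λ a → proj₁ ∘ star₂-elim V D) (c-W (left D′))
    ... | inj₁ comp = proj₂ (complete-elim (star₂ V D) comp) w h
    ... | inj₂ few  = contradiction (≤-trans six few) (from-no (6 ≤? 5))
      where
      P : Pred n
      P w = c z′ w ∧ star₂ V D w
      table : (w z z′ a b d e f : Bool) → Bool
      table w z z′ a b d e f = shape w (a ∷ b ∷ d ∷ e ∷ f ∷ []) ∧ (w ∧ not (a ∨ b ∨ f) ⇒ z′) ∧ (d ∧ not (a ∨ b ∨ e ∨ f) ⇒ not z)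
      hyp : ∀ w → table (W w) (c z w) (c z′ w) (c (v 0F) w) (c (v 1F) w) (c (v 2F) w) (c (v 3F) w) (c (v 4F) w) ≡ true
      hyp w = ∧-intro (shaped V w) (∧-intro
        (⇒-intro λ h →
          let Ww , h′ = ∧-elim h
              h₀ , h₁₄ = ∨-false (not-elim h′)
              h₁ , h₄ = ∨-false h₁₄
          in all D′ w (Ww , λ { 0F _ _ → h₀ ; 1F _ _ → h₁ ; 2F 2≢2 _ → contradiction refl 2≢2
                              ; 3F _ 3≢3 → contradiction refl 3≢3 ; 4F _ _ → h₄ }))
        (⇒-intro λ h →
          let h₂ , h′ = ∧-elim h
              h₀ , h₁₃₄ = ∨-false (not-elim h′)
              h₁ , h₃₄ = ∨-false h₁₃₄
              h₃ , h₄ = ∨-false h₃₄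
          in not-intro (private-apart V (left D) (right D) h₂ λ
               { 0F _ → h₀ ; 1F _ → h₁ ; 2F 2≢2 → contradiction refl 2≢2 ; 3F _ → h₃ ; 4F _ → h₄ })))
      six : 6 ≤ # P
      six = +-cancelʳ-≤ 20 6 _
        (compare (W ∷ c z ∷ c z′ ∷ stars v)
          (λ { (w ∷ z ∷ z′ ∷ a ∷ b ∷ d ∷ e ∷ f ∷ []) → table w z z′ a b d e f
             , d ∷ []
             , (z′ ∧ (w ∧ not (z ∨ e ∨ f))) ∷ (a ∧ d) ∷ (b ∧ d) ∷ (d ∧ e) ∷ (d ∧ f) ∷ [] })
          refl hyp (degree≥ V 2F ∷ [])
          (≤-refl ∷ com V 0F 2F (λ ()) ∷ com V 1F 2F (λ ()) ∷ com V 2F 3F (λ ()) ∷ com V 2F 4F (λ ()) ∷ []))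

  module _ {v : Fin 5 → Fin n} (V : Coclique v) {z z′ : Fin n}
           (D : Dominates v 0F 1F z) (D′ : Dominates v 2F 3F z′) where

    private
      -- Exchanging v₂ and v₃ turns `star₂` into its analogue star₃.
      V″ : Coclique (v ∘ σ₃₂)
      V″ = reindex V σ₃₂ (injective π₃₂)
      D₃₂ : Dominates (v ∘ σ₃₂) 0F 1F z
      D₃₂ = Dominates-reindex π₃₂ D
      D′₃₂ : Dominates (v ∘ σ₃₂) 2F 3F z′
      D′₃₂ = Dominates-reindex π₃₂ (Dominates-flip D′)

    -- The neighbourhood of z′ contains star₂ and star₃, of 16 - n₂ and 16 - n₃ vertices, where
    -- n_k counts the neighbours of z covered by v_k alone among v₂, v₃, v₄.
    few-beyond : ⟦ dominated v 0F 2F ⟧ + (⟦ dominated v 1F 2F ⟧ + (⟦ dominated v 0F 3F ⟧ + (⟦ dominated v 1F 3F ⟧ +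
                 (⟦ dominated v 2F 4F ⟧ + (⟦ dominated v 3F 4F ⟧ + (# (λ w → c z w ∧ c (v 4F) w) + 0)))))) ≤ 2
    -- The fixed lower bounds are 80 + 5 + 9 twice and 1 for `z′` itself, in all 189. The upper
    -- bounds are seven degrees 26 and one 9, in all 191.
    few-beyond = +-cancelˡ-≤ 189 _ _
      (compare (W ∷ c z ∷ c z′ ∷ stars v)
        (λ { (w ∷ z ∷ z′ ∷ a ∷ b ∷ d ∷ e ∷ f ∷ []) →
             table w z z′ a b d e f
           , w ∷ (e ∧ f) ∷ (z ∧ (d ∨ e ∨ f)) ∷ w ∷ (d ∧ f) ∷ (z ∧ (d ∨ e ∨ f)) ∷ (z′ ∧ (d ∧ e))
             ∷ (z ∧ z′ ∧ (a ∧ d)) ∷ (z ∧ z′ ∧ (b ∧ d)) ∷ (z ∧ z′ ∧ (a ∧ e)) ∷ (z ∧ z′ ∧ (b ∧ e))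
             ∷ (z′ ∧ (d ∧ f)) ∷ (z′ ∧ (e ∧ f)) ∷ (z ∧ f) ∷ []
           , e ∷ f ∷ z ∷ d ∷ f ∷ z ∷ (z ∧ (d ∨ e ∨ f)) ∷ z′ ∷ [] })
        refl hyp
        (≤-reflexive (sym order) ∷ exact₃₄ V ∷ beyond≥9 V D ∷ ≤-reflexive (sym order) ∷ exact₂₄ V ∷ beyond≥9 V D
          ∷ #-positive _ z′ (∧-intro (c-refl (c-W (left D′))) (∧-intro (left D′) (right D′)))
          ∷ flag≤# _ (λ h → let u , Du = dominated-member v 0F 2F h in
              u , ∧-intro (dominators-adjacent V D Du)
                    (∧-intro (dominators-adjacent V D′ (Dominates-flip Du)) (∧-intro (left Du) (right Du))))
          ∷ flag≤# _ (λ h → let u , Du = dominated-member v 1F 2F h in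
              u , ∧-intro (dominators-adjacent V (Dominates-flip D) Du)
                    (∧-intro (dominators-adjacent V D′ (Dominates-flip Du)) (∧-intro (left Du) (right Du))))
          ∷ flag≤# _ (λ h → let u , Du = dominated-member v 0F 3F h in
              u , ∧-intro (dominators-adjacent V D Du)
                    (∧-intro (dominators-adjacent V (Dominates-flip D′) (Dominates-flip Du)) (∧-intro (left Du) (right Du))))
          ∷ flag≤# _ (λ h → let u , Du = dominated-member v 1F 3F h in
              u , ∧-intro (dominators-adjacent V (Dominates-flip D) Du)
                    (∧-intro (dominators-adjacent V (Dominates-flip D′) (Dominates-flip Du)) (∧-intro (left Du) (right Du))))
          ∷ flag≤# _ (λ h → let u , Du = dominated-member v 2F 4F h in
              u , ∧-intro (dominators-adjacent V D′ Du) (∧-intro (left Du) (right Du)))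
          ∷ flag≤# _ (λ h → let u , Du = dominated-member v 3F 4F h in
              u , ∧-intro (dominators-adjacent V (Dominates-flip D′) Du) (∧-intro (left Du) (right Du)))
          ∷ ≤-refl ∷ [])
        (degree≤ V 3F ∷ degree≤ V 4F ∷ degree-z ∷ degree≤ V 2F ∷ degree≤ V 4F ∷ degree-z ∷ beyond≤9 V D
          ∷ ≤-reflexive (degree (c-W (left D′))) ∷ []))
      where
      degree-z : # (c z) ≤ 26
      degree-z = ≤-reflexive (degree (c-W (left D)))
      table : (w z z′ a b d e f : Bool) → Bool
      table w z z′ a b d e f = region V D w z a b d e f ∧ (z′ ⇒ w)
        ∧ (w ∧ not (z ∨ e ∨ f) ⇒ z′) ∧ (w ∧ not (z ∨ d ∨ f) ⇒ z′)
      hyp : ∀ w → table (W w) (c z w) (c z′ w) (c (v 0F) w) (c (v 1F) w) (c (v 2F) w) (c (v 3F) w) (c (v 4F) w) ≡ true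
      hyp w = ∧-intro (regional V D w) (∧-intro (⇒-intro c-W)
        (∧-intro (⇒-intro (star₂-complete V D D′ w)) (⇒-intro (star₂-complete V″ D₃₂ D′₃₂ w))))

    few-common₄ : # (λ w → c z w ∧ c (v 4F) w) ≤ 2
    few-common₄ = ≤-trans (≤-reflexive (sym (+-identityʳ _)))
      (m+n≤o⇒n≤o f₃₄ (m+n≤o⇒n≤o f₂₄ (m+n≤o⇒n≤o f₁₃ (m+n≤o⇒n≤o f₀₃ (m+n≤o⇒n≤o f₁₂ (m+n≤o⇒n≤o f₀₂ few-beyond))))))
      where
      f₀₂ = ⟦ dominated v 0F 2F ⟧
      f₁₂ = ⟦ dominated v 1F 2F ⟧
      f₀₃ = ⟦ dominated v 0F 3F ⟧
      f₁₃ = ⟦ dominated v 1F 3F ⟧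
      f₂₄ = ⟦ dominated v 2F 4F ⟧
      f₃₄ = ⟦ dominated v 3F 4F ⟧

  -- Constraints on the graph of dominated pairs

  σ₂₄₃ σ₃₄₂ : Fin 5 → Fin 5
  σ₂₄₃ = lookup (0F ∷ 1F ∷ 2F ∷ 4F ∷ 3F ∷ [])
  σ₃₄₂ = lookup (0F ∷ 1F ∷ 3F ∷ 4F ∷ 2F ∷ [])

  -- Each edge of the triangle 234 serves in turn as the second dominated pair. So `z` shares at
  -- most 2 neighbours with each of v₂, v₃, v₄, but it has 9 neighbours in the union of their stars.
  no-disjoint-triangle : ∀ {v} → Coclique v → dominated v 0F 1F ≡ true → dominated v 2F 3F ≡ true →
                         dominated v 2F 4F ≡ true → ¬ dominated v 3F 4F ≡ true
  no-disjoint-triangle {v} V h₀₁ h₂₃ h₂₄ h₃₄ = contradiction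
    (compare (c z ∷ stars v)
      (λ { (z ∷ a ∷ b ∷ d ∷ e ∷ f ∷ []) → true
         , (z ∧ (d ∨ e ∨ f)) ∷ []
         , (z ∧ d) ∷ (z ∧ e) ∷ (z ∧ f) ∷ [] })
      refl (λ _ → refl) (beyond≥9 V D ∷ [])
      ( few-common₄ (reindex V σ₃₄₂ (injective π₃₄₂)) (Dominates-reindex π₃₄₂ {0F} {1F} D) (Dominates-reindex π₃₄₂ {2F} {3F} D₃₄)
      ∷ few-common₄ (reindex V σ₂₄₃ (injective π₂₄₃)) (Dominates-reindex π₂₄₃ {0F} {1F} D) (Dominates-reindex π₂₄₃ {2F} {3F} D₂₄)
      ∷ few-common₄ V D D₂₃ ∷ []))
    (from-no (9 ≤? 6))
    where
    z = proj₁ (dominated-member v 0F 1F h₀₁)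
    D = proj₂ (dominated-member v 0F 1F h₀₁)
    D₂₃ = proj₂ (dominated-member v 2F 3F h₂₃)
    D₂₄ = proj₂ (dominated-member v 2F 4F h₂₄)
    D₃₄ = proj₂ (dominated-member v 3F 4F h₃₄)
    π₂₄₃ : Permutes σ₂₄₃
    π₂₄₃ = from-yes (permutes? σ₂₄₃)
    π₃₄₂ : Permutes σ₃₄₂
    π₃₄₂ = from-yes (permutes? σ₃₄₂)

  -- All pairs except 01 and 23. The first six come in the order of `few-beyond`.
  eight : (Fin 5 → Fin 5 → Bool) → ℕ
  eight g = trues (g 0F 2F ∷ g 1F 2F ∷ g 0F 3F ∷ g 1F 3F ∷ g 2F 4F ∷ g 3F 4F ∷ g 0F 4F ∷ g 1F 4F ∷ [])

  -- Vertices dominating 04 or 14 are common neighbours of `z` and v₄, so the last count in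
  -- `few-beyond` accounts for these two pairs.
  few-dominated : ∀ {v} → Coclique v → dominated v 0F 1F ≡ true → dominated v 2F 3F ≡ true →
                  eight (dominated v) ≤ 2
  few-dominated {v} V h₀₁ h₂₃ = ≤-trans
    (+-monoʳ-≤ ⟦ dominated v 0F 2F ⟧ (+-monoʳ-≤ ⟦ dominated v 1F 2F ⟧ (+-monoʳ-≤ ⟦ dominated v 0F 3F ⟧
      (+-monoʳ-≤ ⟦ dominated v 1F 3F ⟧ (+-monoʳ-≤ ⟦ dominated v 2F 4F ⟧ (+-monoʳ-≤ ⟦ dominated v 3F 4F ⟧ fourth))))))
    (few-beyond V D D′)
    where
    D = proj₂ (dominated-member v 0F 1F h₀₁)
    D′ = proj₂ (dominated-member v 2F 3F h₂₃)
    z = proj₁ (dominated-member v 0F 1F h₀₁)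
    fourth : ⟦ dominated v 0F 4F ⟧ + (⟦ dominated v 1F 4F ⟧ + 0) ≤ # (λ w → c z w ∧ c (v 4F) w) + 0
    fourth = compare (W ∷ c z ∷ stars v)
      (λ { (w ∷ z ∷ a ∷ b ∷ d ∷ e ∷ f ∷ []) → shape w (a ∷ b ∷ d ∷ e ∷ f ∷ [])
         , (z ∧ (a ∧ f)) ∷ (z ∧ (b ∧ f)) ∷ []
         , (z ∧ f) ∷ [] })
      refl (shaped V)
      ( flag≤# _ (λ h → let u , Du = dominated-member v 0F 4F h in
          u , ∧-intro (dominators-adjacent V D Du) (∧-intro (left Du) (right Du)))
      ∷ flag≤# _ (λ h → let u , Du = dominated-member v 1F 4F h in
          u , ∧-intro (dominators-adjacent V (Dominates-flip D) Du) (∧-intro (left Du) (right Du)))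
      ∷ [])
      (≤-refl ∷ [])

  -- The conditions for one labelling only; relabelling supplies the others.
  admissible : (Fin 5 → Fin 5 → Bool) → Bool
  admissible g = (g 0F 1F ∨ g 0F 2F ∨ g 1F 2F)
               ∧ (g 0F 1F ∧ g 2F 3F ⇒ (eight g ≤ᵇ 2) ∧ not (g 2F 4F ∧ g 3F 4F))

  dominated-admissible : ∀ {v} → Coclique v → admissible (dominated v) ≡ true
  dominated-admissible {v} V = ∧-intro (some-dominated V) (⇒-intro λ h →
    let h₀₁ , h₂₃ = ∧-elim h in ∧-intro (≤ᵇ-complete (few-dominated V h₀₁ h₂₃)) (no-triangle h₀₁ h₂₃))
    where
    no-triangle : dominated v 0F 1F ≡ true → dominated v 2F 3F ≡ true →
                  not (dominated v 2F 4F ∧ dominated v 3F 4F) ≡ true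
    no-triangle h₀₁ h₂₃ with dominated v 2F 4F in h₂₄ | dominated v 3F 4F in h₃₄
    ... | false | _     = refl
    ... | true  | false = refl
    ... | true  | true  = ⊥-elim (no-disjoint-triangle V h₀₁ h₂₃ h₂₄ h₃₄)

  relation : Vec Bool 10 → Fin 5 → Fin 5 → Bool
  relation (a ∷ b ∷ d ∷ e ∷ f ∷ g ∷ h ∷ k ∷ l ∷ m ∷ []) i j = lookup (lookup rows i) j
    where
    rows : Vec (Vec Bool 5) 5
    rows = (false ∷ a ∷ b ∷ d ∷ e ∷ []) ∷ (a ∷ false ∷ f ∷ g ∷ h ∷ []) ∷ (b ∷ f ∷ false ∷ k ∷ l ∷ [])
         ∷ (d ∷ g ∷ k ∷ false ∷ m ∷ []) ∷ (e ∷ h ∷ l ∷ m ∷ false ∷ []) ∷ []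

  -- Found by search: every graph on five vertices is inadmissible after one of these relabellings.
  relabellings : Vec (Vec (Fin 5) 5) 11
  relabellings =
      (3F ∷ 2F ∷ 4F ∷ 1F ∷ 0F ∷ []) ∷ (0F ∷ 1F ∷ 4F ∷ 3F ∷ 2F ∷ []) ∷ (3F ∷ 1F ∷ 4F ∷ 0F ∷ 2F ∷ [])
    ∷ (3F ∷ 0F ∷ 2F ∷ 4F ∷ 1F ∷ []) ∷ (0F ∷ 2F ∷ 1F ∷ 4F ∷ 3F ∷ []) ∷ (3F ∷ 4F ∷ 0F ∷ 2F ∷ 1F ∷ [])
    ∷ (2F ∷ 1F ∷ 3F ∷ 0F ∷ 4F ∷ []) ∷ (4F ∷ 1F ∷ 2F ∷ 0F ∷ 3F ∷ []) ∷ (0F ∷ 4F ∷ 2F ∷ 3F ∷ 1F ∷ [])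
    ∷ (0F ∷ 1F ∷ 3F ∷ 4F ∷ 2F ∷ []) ∷ (4F ∷ 2F ∷ 3F ∷ 1F ∷ 0F ∷ []) ∷ []

  relabelled : (Fin 5 → Fin 5 → Bool) → Fin 11 → Fin 5 → Fin 5 → Bool
  relabelled g s i j = g (lookup (lookup relabellings s) i) (lookup (lookup relabellings s) j)

  relabellings-permute : ∀ s → Permutes (lookup (lookup relabellings s))
  relabellings-permute = from-yes (all? λ s → permutes? (lookup (lookup relabellings s)))

  conjunction : ∀ {k} → (Fin k → Bool) → Bool
  conjunction {zero}  f = true
  conjunction {suc k} f = f 0F ∧ conjunction (f ∘ suc)

  conjunction-intro : ∀ {k} {f : Fin k → Bool} → (∀ i → f i ≡ true) → conjunction f ≡ true
  conjunction-intro {zero}  h = refl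
  conjunction-intro {suc k} h = ∧-intro (h 0F) (conjunction-intro (h ∘ suc))

  admissible-cong : ∀ {g g′} → (∀ i j → i ≢ j → g i j ≡ g′ i j) → admissible g ≡ admissible g′
  admissible-cong {g} {g′} h
    rewrite h 0F 1F (λ ()) | h 0F 2F (λ ()) | h 1F 2F (λ ()) | h 2F 3F (λ ()) | h 0F 3F (λ ())
          | h 1F 3F (λ ()) | h 2F 4F (λ ()) | h 3F 4F (λ ()) | h 0F 4F (λ ()) | h 1F 4F (λ ()) = refl

  -- All 1024 graphs are evaluated. A reason that none survives all relabellings: nondominated pairs
  -- form no triangle, so by Mantel at least 4 pairs are dominated, with equality only for an edge
  -- and a disjoint triangle. They are not all at one vertex, so two of them are disjoint; then at
  -- most 4 are dominated, and the edge with its disjoint triangle is excluded too.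
  no-5-coclique : ∀ {v : Fin 5 → Fin n} → ¬ Coclique v
  no-5-coclique {v} V = clash
    (conjunction-intro λ s → trans (admissible-cong λ i j i≢j →
        trans (agrees _ _ (injective (relabellings-permute s) i j i≢j))
              (sym (dominated-reindex v (relabellings-permute s) i j)))
      (dominated-admissible (reindex V _ (injective (relabellings-permute s)))))
    (not-elim (valid-sound 10 (λ bs → not (conjunction λ s → admissible (relabelled (relation bs) s))) refl bits))
    where
    d = dominated v
    bits : Vec Bool 10
    bits = d 0F 1F ∷ d 0F 2F ∷ d 0F 3F ∷ d 0F 4F ∷ d 1F 2F ∷ d 1F 3F ∷ d 1F 4F ∷ d 2F 3F ∷ d 2F 4F ∷ d 3F 4F ∷ []
    symmetric : ∀ i j → d i j ≡ d j i
    symmetric = dominated-sym v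
    agrees : ∀ i j → i ≢ j → relation bits i j ≡ d i j
    agrees 0F 0F i≢j = contradiction refl i≢j
    agrees 0F 1F _ = refl
    agrees 0F 2F _ = refl
    agrees 0F 3F _ = refl
    agrees 0F 4F _ = refl
    agrees 1F 0F _ = symmetric 0F 1F
    agrees 1F 1F i≢j = contradiction refl i≢j
    agrees 1F 2F _ = refl
    agrees 1F 3F _ = refl
    agrees 1F 4F _ = refl
    agrees 2F 0F _ = symmetric 0F 2F
    agrees 2F 1F _ = symmetric 1F 2F
    agrees 2F 2F i≢j = contradiction refl i≢j
    agrees 2F 3F _ = refl
    agrees 2F 4F _ = refl
    agrees 3F 0F _ = symmetric 0F 3F
    agrees 3F 1F _ = symmetric 1F 3F
    agrees 3F 2F _ = symmetric 2F 3F
    agrees 3F 3F i≢j = contradiction refl i≢j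
    agrees 3F 4F _ = refl
    agrees 4F 0F _ = symmetric 0F 4F
    agrees 4F 1F _ = symmetric 1F 4F
    agrees 4F 2F _ = symmetric 2F 4F
    agrees 4F 3F _ = symmetric 3F 4F
    agrees 4F 4F i≢j = contradiction refl i≢j

-- Partition of the local graph into four 20-cliques

module FourCliques {n : ℕ} (Γ : Local n)
                   (clique≤20 : ∀ A → LocalTheory.Clique Γ A → # A ≤ 20) where
  open LocalTheory Γ
  open FiveCoclique Γ using (no-5-coclique)

  -- A greedy choice: three closed neighbourhoods hold at most 3 · 26 = 78 of the 80 vertices.
  4-coclique : ∃[ v ] Coclique {4} v
  4-coclique = _ , coclique
      ( (proj₁ u₃-new , λ { 0F → apart₃₂ ; 1F → apart₃₁ ; 2F → apart₃₀ })
      ◂ (proj₁ u₂-new , λ { 0F → apart₂₁ ; 1F → apart₂₀ })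
      ◂ (proj₁ u₁-new , λ { 0F → trans (c-sym _ _) (not-elim (proj₂ u₁-new)) })
      ◂ (proj₂ u₀ , λ ()) ◂ [])
    where
    u₀ : ∃[ u ] W u ≡ true
    u₀ = member W (≤-trans (s≤s z≤n) (≤-reflexive (sym order)))
    c₀ = c (proj₁ u₀)
    c₀≤26 : # c₀ ≤ 26
    c₀≤26 = ≤-reflexive (degree (proj₂ u₀))
    free₁ free₂ free₃ : Pred n
    free₁ w = W w ∧ not (c₀ w)
    u₁ : ∃[ u ] free₁ u ≡ true
    u₁ = member free₁ (+-cancelʳ-≤ 26 1 _ (≤-trans (m≤m+n 27 53) (compare (W ∷ c₀ ∷ [])
      (λ { (w ∷ a ∷ []) → true , w ∷ [] , (w ∧ not a) ∷ a ∷ [] })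
      refl (λ _ → refl) (≤-reflexive (sym order) ∷ []) (≤-refl ∷ c₀≤26 ∷ []))))
    u₁-new = ∧-elim (proj₂ u₁)
    c₁ = c (proj₁ u₁)
    c₁≤26 : # c₁ ≤ 26
    c₁≤26 = ≤-reflexive (degree (proj₁ u₁-new))
    free₂ w = W w ∧ not (c₀ w ∨ c₁ w)
    u₂ : ∃[ u ] free₂ u ≡ true
    u₂ = member free₂ (+-cancelʳ-≤ 52 1 _ (≤-trans (m≤m+n 53 27) (compare (W ∷ c₀ ∷ c₁ ∷ [])
      (λ { (w ∷ a ∷ b ∷ []) → true , w ∷ [] , (w ∧ not (a ∨ b)) ∷ a ∷ b ∷ [] })
      refl (λ _ → refl) (≤-reflexive (sym order) ∷ []) (≤-refl ∷ c₀≤26 ∷ c₁≤26 ∷ []))))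
    u₂-new = ∧-elim (proj₂ u₂)
    apart₂₀ : c (proj₁ u₂) (proj₁ u₀) ≡ false
    apart₂₀ = trans (c-sym _ _) (proj₁ (∨-false (not-elim (proj₂ u₂-new))))
    apart₂₁ : c (proj₁ u₂) (proj₁ u₁) ≡ false
    apart₂₁ = trans (c-sym _ _) (proj₂ (∨-false (not-elim (proj₂ u₂-new))))
    c₂ = c (proj₁ u₂)
    free₃ w = W w ∧ not (c₀ w ∨ c₁ w ∨ c₂ w)
    u₃ : ∃[ u ] free₃ u ≡ true
    u₃ = member free₃ (+-cancelʳ-≤ 78 1 _ (≤-trans (m≤m+n 79 1) (compare (W ∷ c₀ ∷ c₁ ∷ c₂ ∷ [])
      (λ { (w ∷ a ∷ b ∷ d ∷ []) → true , w ∷ [] , (w ∧ not (a ∨ b ∨ d)) ∷ a ∷ b ∷ d ∷ [] })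
      refl (λ _ → refl) (≤-reflexive (sym order) ∷ [])
      (≤-refl ∷ c₀≤26 ∷ c₁≤26 ∷ ≤-reflexive (degree (proj₁ u₂-new)) ∷ []))))
    u₃-new = ∧-elim (proj₂ u₃)
    apart₃ = ∨-false (not-elim (proj₂ u₃-new))
    apart₃₀ : c (proj₁ u₃) (proj₁ u₀) ≡ false
    apart₃₀ = trans (c-sym _ _) (proj₁ apart₃)
    apart₃₁ : c (proj₁ u₃) (proj₁ u₁) ≡ false
    apart₃₁ = trans (c-sym _ _) (proj₁ (∨-false (proj₂ apart₃)))
    apart₃₂ : c (proj₁ u₃) (proj₁ u₂) ≡ false
    apart₃₂ = trans (c-sym _ _) (proj₂ (∨-false (proj₂ apart₃)))

  σ-permutes : ∀ (i : Fin 4) → Permutes (swap₀ i)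
  σ-permutes = from-yes (all? λ i → permutes? (swap₀ {3} i))

  own : (Fin 4 → Fin n) → Fin 4 → Pred n
  own v i = uncovered v i i

  covered : ∀ {v : Fin 4 → Fin n} → Coclique v → ∀ {w} → W w ≡ true →
            c (v 0F) w ∨ c (v 1F) w ∨ c (v 2F) w ∨ c (v 3F) w ≡ true
  covered {v} V {w} Ww = ¬-not λ h →
    let h₀ , h′ = ∨-false h
        h₁ , h″ = ∨-false h′
        h₂ , h₃ = ∨-false h″
    in no-5-coclique (coclique
      ( (Ww , λ { 0F → trans (c-sym _ _) h₀ ; 1F → trans (c-sym _ _) h₁
                ; 2F → trans (c-sym _ _) h₂ ; 3F → trans (c-sym _ _) h₃ })
      ◂ (inW V 0F , λ { 0F → apart V 0F 1F (λ ()) ; 1F → apart V 0F 2F (λ ()) ; 2F → apart V 0F 3F (λ ()) })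
      ◂ (inW V 1F , λ { 0F → apart V 1F 2F (λ ()) ; 1F → apart V 1F 3F (λ ()) })
      ◂ (inW V 2F , λ { 0F → apart V 2F 3F (λ ()) })
      ◂ (inW V 3F , λ ()) ◂ []))

  -- 26 - 3 · 5 = 11.
  eleven₀ : ∀ {v} → Coclique v → 11 ≤ # (own v 0F)
  eleven₀ {v} V = +-cancelʳ-≤ 15 11 _
    (compare (own v 0F ∷ W ∷ c (v 0F) ∷ c (v 1F) ∷ c (v 2F) ∷ c (v 3F) ∷ [])
      (λ { (o ∷ w ∷ a ∷ b ∷ d ∷ e ∷ []) → (a ∧ not (b ∨ d ∨ e) ⇒ o)
         , a ∷ []
         , o ∷ (a ∧ b) ∷ (a ∧ d) ∷ (a ∧ e) ∷ [] })
      refl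
      (λ w → ⇒-intro λ h →
        let h₀ , h′ = ∧-elim h
            h₁ , h″ = ∨-false (not-elim h′)
            h₂ , h₃ = ∨-false h″
        in uncovered-intro v 0F 0F (c-W h₀ , λ { 0F 0≢0 _ → contradiction refl 0≢0
             ; 1F _ _ → h₁ ; 2F _ _ → h₂ ; 3F _ _ → h₃ }))
      (≤-reflexive (sym (deg V 0F)) ∷ [])
      (≤-refl ∷ com V 0F 1F (λ ()) ∷ com V 0F 2F (λ ()) ∷ com V 0F 3F (λ ()) ∷ []))

  -- Two nonadjacent private neighbours of v₀ could replace v₀ and give a 5-coclique.
  own-clique₀ : ∀ {v} → Coclique v → Clique (own v 0F)
  own-clique₀ {v} V p q hp hq with c p q in p≁q
  ... | true  = refl
  ... | false = ⊥-elim (no-5-coclique (coclique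
      ( (proj₁ p-own , λ { 0F → p≁q ; 1F → p≁ 1F (λ ()) ; 2F → p≁ 2F (λ ()) ; 3F → p≁ 3F (λ ()) })
      ◂ (proj₁ q-own , λ { 0F → q≁ 1F (λ ()) ; 1F → q≁ 2F (λ ()) ; 2F → q≁ 3F (λ ()) })
      ◂ (inW V 1F , λ { 0F → apart V 1F 2F (λ ()) ; 1F → apart V 1F 3F (λ ()) })
      ◂ (inW V 2F , λ { 0F → apart V 2F 3F (λ ()) })
      ◂ (inW V 3F , λ ()) ◂ [])))
    where
    p-own = uncovered-elim v 0F 0F hp
    q-own = uncovered-elim v 0F 0F hq
    p≁ : ∀ k → k ≢ 0F → c p (v k) ≡ false
    p≁ k k≢0 = trans (c-sym _ _) (proj₂ p-own k k≢0 k≢0)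
    q≁ : ∀ k → k ≢ 0F → c q (v k) ≡ false
    q≁ k k≢0 = trans (c-sym _ _) (proj₂ q-own k k≢0 k≢0)

  module _ {v : Fin 4 → Fin n} (V : Coclique v) where

    A : Fin 4 → Pred n
    A = own v

    eleven : ∀ i → 11 ≤ # (A i)
    eleven i = ≤-trans (eleven₀ (reindex V (swap₀ i) (injective (σ-permutes i))))
      (#-mono λ w h → uncovered-intro v i i
        (Uncovered-unreindex (σ-permutes i) (uncovered-elim (v ∘ swap₀ i) 0F 0F h)))

    A-clique : ∀ i → Clique (A i)
    A-clique i p q hp hq = own-clique₀ (reindex V (swap₀ i) (injective (σ-permutes i))) p q (to hp) (to hq)
      where
      to : ∀ {w} → A i w ≡ true → own (v ∘ swap₀ i) 0F w ≡ true
      to h = uncovered-intro (v ∘ swap₀ i) 0F 0F (Uncovered-reindex (σ-permutes i) (uncovered-elim v i i h))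

    A-apart : ∀ i {k w} → A i w ≡ true → k ≢ i → c w (v k) ≡ false
    A-apart i {k} h k≢i = trans (c-sym _ _) (proj₂ (uncovered-elim v i i h) k k≢i k≢i)

    A⊆W : ∀ i {w} → A i w ≡ true → W w ≡ true
    A⊆W i h = proj₁ (uncovered-elim v i i h)

    v∈A : ∀ i → A i (v i) ≡ true
    v∈A i = uncovered-intro v i i (inW V i , λ k k≢i _ → apart V k i k≢i)

    C : Fin 4 → Pred n
    C i = complete (A i)

    six-missed : ∀ i {z} → # (λ w → c z w ∧ A i w) ≤ 5 → 6 ≤ # (λ w → not (c z w) ∧ A i w)
    six-missed i {z} few = +-cancelˡ-≤ 5 6 _ (≤-trans
      (compare (c z ∷ A i ∷ [])
        (λ { (z ∷ a ∷ []) → true , a ∷ [] , (z ∧ a) ∷ (not z ∧ a) ∷ [] })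
        refl (λ _ → refl) (eleven i ∷ []) (few ∷ ≤-refl ∷ []))
      (≤-reflexive (cong (5 +_) (+-identityʳ _))))

    -- Otherwise `z` misses at least six vertices in each of `A i` and `A j`. A missed `p` in `A i`
    -- and a missed `q` in `A j` are adjacent, or they would form a 5-coclique with `z`, `v k`,
    -- `v l`. So `p` has six neighbours in the clique `A j` and is adjacent to all of it, even to
    -- `v j`, contrary to its being private to `v i`.
    complete-to-one : ∀ i j k l {z} → i ≢ j → i ≢ k → i ≢ l → j ≢ k → j ≢ l → k ≢ l → W z ≡ true →
                      c (v k) z ≡ false → c (v l) z ≡ false → C i z ≡ true ⊎ C j z ≡ true
    complete-to-one i j k l {z} i≢j i≢k i≢l j≢k j≢l k≢l Wz k≁z l≁z =
      choose (complete-or-few (A i) (A-clique i) (λ a → A⊆W i) Wz) (complete-or-few (A j) (A-clique j) (λ a → A⊆W j) Wz)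
      where
      adjacent : ∀ p q → c z p ≡ false → A i p ≡ true → c z q ≡ false → A j q ≡ true → c p q ≡ true
      adjacent p q z≁p p∈A z≁q q∈A = ¬-not λ p≁q → no-5-coclique (coclique
          ( (Wz , λ { 0F → z≁p ; 1F → z≁q ; 2F → trans (c-sym _ _) k≁z ; 3F → trans (c-sym _ _) l≁z })
          ◂ (A⊆W i p∈A , λ { 0F → p≁q ; 1F → A-apart i p∈A (i≢k ∘ sym) ; 2F → A-apart i p∈A (i≢l ∘ sym) })
          ◂ (A⊆W j q∈A , λ { 0F → A-apart j q∈A (j≢k ∘ sym) ; 1F → A-apart j q∈A (j≢l ∘ sym) })
          ◂ (inW V k , λ { 0F → apart V k l k≢l })
          ◂ (inW V l , λ ()) ◂ []))
      impossible : ∀ p → c z p ≡ false → A i p ≡ true → # (λ w → c z w ∧ A j w) ≤ 5 →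
                   ¬ (C j p ≡ true ⊎ # (λ w → c p w ∧ A j w) ≤ 5)
      impossible p z≁p p∈A fewⱼ (inj₁ comp) =
        clash (proj₂ (complete-elim (A j) comp) (v j) (v∈A j)) (A-apart i p∈A (i≢j ∘ sym))
      impossible p z≁p p∈A fewⱼ (inj₂ few)  = contradiction
        (≤-trans (six-missed j fewⱼ) (≤-trans (#-mono λ q h → let z≁q , q∈A = ∧-elim h in
          ∧-intro (adjacent p q z≁p p∈A (not-elim z≁q) q∈A) q∈A) few))
        (from-no (6 ≤? 5))
      choose : C i z ≡ true ⊎ # (λ w → c z w ∧ A i w) ≤ 5 → C j z ≡ true ⊎ # (λ w → c z w ∧ A j w) ≤ 5 →
               C i z ≡ true ⊎ C j z ≡ true
      choose (inj₁ comp) _           = inj₁ comp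
      choose (inj₂ _)    (inj₁ comp) = inj₂ comp
      choose (inj₂ fewᵢ) (inj₂ fewⱼ) =
        let p , h = member (λ w → not (c z w) ∧ A i w) (≤-trans (s≤s z≤n) (six-missed i fewᵢ))
            z≁p , p∈A = ∧-elim h
        in ⊥-elim (impossible p (not-elim z≁p) p∈A fewⱼ
             (complete-or-few (A j) (A-clique j) (λ a → A⊆W j) (A⊆W i p∈A)))

    C⊆W : ∀ i {w} → C i w ≡ true → W w ≡ true
    C⊆W i h = proj₁ (complete-elim (A i) h)

    C-clique : ∀ i → Clique (C i)
    C-clique i p q hp hq = complete-to-six (A i) (≤-trans (m≤m+n 6 5) (eleven i))
      (proj₂ (complete-elim (A i) hp)) (proj₂ (complete-elim (A i) hq)) (C⊆W i hp) (C⊆W i hq)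

    rest : Pred n
    rest w = W w ∧ not (C 0F w ∨ C 1F w ∨ C 2F w ∨ C 3F w)

    rest-elim : ∀ {z} → rest z ≡ true → W z ≡ true × (∀ i → C i z ≡ false)
    rest-elim h =
      let Wz , h′ = ∧-elim h
          h₀ , h₁₂₃ = ∨-false (not-elim h′)
          h₁ , h₂₃ = ∨-false h₁₂₃
          h₂ , h₃ = ∨-false h₂₃
      in Wz , λ { 0F → h₀ ; 1F → h₁ ; 2F → h₂ ; 3F → h₃ }

    -- A vertex of rest is covered at least three times.
    rest≤6 : # rest ≤ 6
    rest≤6 = +-cancelˡ-≤ 104 _ _ (≤-trans (≤-reflexive (cong (104 +_) (sym (+-identityʳ _))))
      (compare (W ∷ c (v 0F) ∷ c (v 1F) ∷ c (v 2F) ∷ c (v 3F) ∷ rest ∷ [])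
        (λ { (w ∷ a ∷ b ∷ d ∷ e ∷ r ∷ []) → table w a b d e r
           , a ∷ b ∷ d ∷ e ∷ r ∷ []
           , w ∷ (a ∧ b) ∷ (a ∧ d) ∷ (a ∧ e) ∷ (b ∧ d) ∷ (b ∧ e) ∷ (d ∧ e) ∷ [] })
        refl hyp
        (d 0F ∷ d 1F ∷ d 2F ∷ d 3F ∷ ≤-refl ∷ [])
        (≤-reflexive order ∷ com V 0F 1F (λ ()) ∷ com V 0F 2F (λ ()) ∷ com V 0F 3F (λ ()) ∷ com V 1F 2F (λ ())
          ∷ com V 1F 3F (λ ()) ∷ com V 2F 3F (λ ()) ∷ [])))
      where
      d : ∀ i → 26 ≤ # (c (v i))
      d i = ≤-reflexive (sym (deg V i))
      table : (w a b d e r : Bool) → Bool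
      table w a b d e r = (a ⇒ w) ∧ (b ⇒ w) ∧ (d ⇒ w) ∧ (e ⇒ w) ∧ (w ⇒ a ∨ b ∨ d ∨ e)
        ∧ (r ⇒ (a ∨ b) ∧ (a ∨ d) ∧ (a ∨ e) ∧ (b ∨ d) ∧ (b ∨ e) ∧ (d ∨ e))
      one-of : ∀ k l i j {z} → i ≢ j → i ≢ k → i ≢ l → j ≢ k → j ≢ l → k ≢ l → rest z ≡ true →
               c (v k) z ∨ c (v l) z ≡ true
      one-of k l i j {z} i≢j i≢k i≢l j≢k j≢l k≢l h = ¬-not λ e →
        let k≁z , l≁z = ∨-false e
            Wz , ∉C = rest-elim h
        in excluded ∉C (complete-to-one i j k l i≢j i≢k i≢l j≢k j≢l k≢l Wz k≁z l≁z)
        where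
        excluded : (∀ i → C i z ≡ false) → ¬ (C i z ≡ true ⊎ C j z ≡ true)
        excluded ∉C (inj₁ h) = clash h (∉C i)
        excluded ∉C (inj₂ h) = clash h (∉C j)
      hyp : ∀ w → table (W w) (c (v 0F) w) (c (v 1F) w) (c (v 2F) w) (c (v 3F) w) (rest w) ≡ true
      hyp w = ∧-intro (⇒-intro c-W) (∧-intro (⇒-intro c-W) (∧-intro (⇒-intro c-W) (∧-intro (⇒-intro c-W)
        (∧-intro (⇒-intro (covered V)) (⇒-intro λ r →
          ∧-intro (one-of 0F 1F 2F 3F (λ ()) (λ ()) (λ ()) (λ ()) (λ ()) (λ ()) r)
          (∧-intro (one-of 0F 2F 1F 3F (λ ()) (λ ()) (λ ()) (λ ()) (λ ()) (λ ()) r)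
          (∧-intro (one-of 0F 3F 1F 2F (λ ()) (λ ()) (λ ()) (λ ()) (λ ()) (λ ()) r)
          (∧-intro (one-of 1F 2F 0F 3F (λ ()) (λ ()) (λ ()) (λ ()) (λ ()) (λ ()) r)
          (∧-intro (one-of 1F 3F 0F 2F (λ ()) (λ ()) (λ ()) (λ ()) (λ ()) (λ ()) r)
                   (one-of 2F 3F 0F 1F (λ ()) (λ ()) (λ ()) (λ ()) (λ ()) (λ ()) r))))))))))

    cover : ∀ w → (W w ⇒ C 0F w ∨ C 1F w ∨ C 2F w ∨ C 3F w ∨ rest w) ≡ true
    cover w with W w | C 0F w | C 1F w | C 2F w | C 3F w
    ... | false | _     | _     | _     | _     = refl
    ... | true  | true  | _     | _     | _     = refl
    ... | true  | false | true  | _     | _     = refl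
    ... | true  | false | false | true  | _     = refl
    ... | true  | false | false | false | true  = refl
    ... | true  | false | false | false | false = refl

    -- Some `a` in `A i` is missed by `z`, and `a` is adjacent to all of `C i`.
    few-in-C : ∀ {z} → rest z ≡ true → ∀ i → # (λ w → c z w ∧ C i w) ≤ 5
    few-in-C {z} r i =
      let Wz , ∉C = rest-elim r
          a , Aa , z≁a = complete-false (A i) Wz (∉C i)
      in few-neighbours (C i) (λ b Cb → trans (c-sym _ _) (proj₂ (complete-elim (A i) Cb) a Aa)) Wz (A⊆W i Aa) z≁a

    split : ∀ {z} → rest z ≡ true → ∀ {r₀ r₁ r₂ r₃ r} →
            # (λ w → c z w ∧ C 0F w) ≤ r₀ → # (λ w → c z w ∧ C 1F w) ≤ r₁ → # (λ w → c z w ∧ C 2F w) ≤ r₂ →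
            # (λ w → c z w ∧ C 3F w) ≤ r₃ → # (λ w → c z w ∧ rest w) ≤ r → 26 ≤ r₀ + (r₁ + (r₂ + (r₃ + (r + 0))))
    split {z} h b₀ b₁ b₂ b₃ b =
      compare (W ∷ c z ∷ C 0F ∷ C 1F ∷ C 2F ∷ C 3F ∷ rest ∷ [])
        (λ { (w ∷ z ∷ a ∷ b ∷ d ∷ e ∷ r ∷ []) → (z ⇒ w) ∧ (w ⇒ a ∨ b ∨ d ∨ e ∨ r)
           , z ∷ []
           , (z ∧ a) ∷ (z ∧ b) ∷ (z ∧ d) ∷ (z ∧ e) ∷ (z ∧ r) ∷ [] })
        refl (λ w → ∧-intro (⇒-intro c-W) (cover w))
        (≤-reflexive (sym (degree (proj₁ (rest-elim h)))) ∷ [])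
        (b₀ ∷ b₁ ∷ b₂ ∷ b₃ ∷ b ∷ [])

    rest-few : ∀ z → # (λ w → c z w ∧ rest w) ≤ 6
    rest-few z = ≤-trans (#-mono λ w h → proj₂ (∧-elim {c z w} h)) rest≤6

    -- The upper bounds 5, 5, 5, 5 for the `C i` and 6 for `rest` add up to the degree 26, so all
    -- are attained.
    five-in-C : ∀ {z} → rest z ≡ true → ∀ i → 5 ≤ # (λ w → c z w ∧ C i w)
    five-in-C {z} r 0F = +-cancelʳ-≤ 21 5 _ (split r ≤-refl (few-in-C r 1F) (few-in-C r 2F) (few-in-C r 3F) (rest-few z))
    five-in-C {z} r 1F = +-cancelʳ-≤ 16 5 _ (+-cancelˡ-≤ 5 _ _
      (split r (few-in-C r 0F) ≤-refl (few-in-C r 2F) (few-in-C r 3F) (rest-few z)))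
    five-in-C {z} r 2F = +-cancelʳ-≤ 11 5 _ (+-cancelˡ-≤ 10 _ _
      (split r (few-in-C r 0F) (few-in-C r 1F) ≤-refl (few-in-C r 3F) (rest-few z)))
    five-in-C {z} r 3F = +-cancelʳ-≤ 6 5 _ (+-cancelˡ-≤ 15 _ _
      (split r (few-in-C r 0F) (few-in-C r 1F) (few-in-C r 2F) ≤-refl (rest-few z)))

    six-in-rest : ∀ {z} → rest z ≡ true → 6 ≤ # (λ w → c z w ∧ rest w)
    six-in-rest {z} r = +-cancelʳ-≤ 0 6 _ (+-cancelˡ-≤ 20 _ _
      (split r (few-in-C r 0F) (few-in-C r 1F) (few-in-C r 2F) (few-in-C r 3F) ≤-refl))

    -- A vertex of `rest` has six neighbours in `rest`, itself included, and `rest` has no more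
    -- vertices.
    rest-clique : Clique rest
    rest-clique z w rz rw with c z w in z≁w
    ... | true  = refl
    ... | false = contradiction
      (≤-trans
        (compare (c z ∷ rest ∷ [])
          (λ { (z ∷ r ∷ []) → true , (z ∧ r) ∷ (not z ∧ r) ∷ [] , r ∷ [] })
          refl (λ _ → refl) (six-in-rest rz ∷ #-positive _ w (∧-intro (not-intro z≁w) rw) ∷ []) (rest≤6 ∷ []))
        ≤-refl)
      (from-no (7 ≤? 6))

    -- Otherwise w and z′ would have z and 5 vertices of a C i in common.
    neighbour-complete : ∀ {z z′ w} → rest z ≡ true → rest z′ ≡ true → c z w ≡ true → c w z′ ≡ true
    neighbour-complete {z} {z′} {w} r r′ zw with c w z′ in w≁z′
    ... | true  = refl
    ... | false = ⊥-elim (cases (⇒-elim (cover w) (c-W zw)))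
      where
      impossible : ∀ i → C i w ≡ true → ∀ {A : Set} → A
      impossible i w∈C = contradiction
        (compare (c w ∷ c z′ ∷ C i ∷ [])
          (λ { (w ∷ z′ ∷ a ∷ []) → (a ⇒ w)
             , (z′ ∧ a) ∷ (w ∧ z′ ∧ not a) ∷ []
             , (w ∧ z′) ∷ [] })
          refl (λ u → ⇒-intro (C-clique i w u w∈C))
          (five-in-C r′ i ∷ #-positive _ z (∧-intro (trans (c-sym _ _) zw)
             (∧-intro (rest-clique z′ z r′ r) (not-intro (proj₂ (rest-elim r) i)))) ∷ [])
          (common (c-W zw) (proj₁ (rest-elim r′)) w≁z′ ∷ []))
        (from-no (6 ≤? 5))
      cases : C 0F w ∨ C 1F w ∨ C 2F w ∨ C 3F w ∨ rest w ≡ true → ⊥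
      cases h with ∨-elim h
      ... | inj₁ h₀ = impossible 0F h₀
      ... | inj₂ h with ∨-elim h
      ... | inj₁ h₁ = impossible 1F h₁
      ... | inj₂ h with ∨-elim h
      ... | inj₁ h₂ = impossible 2F h₂
      ... | inj₂ h with ∨-elim h
      ... | inj₁ h₃ = impossible 3F h₃
      ... | inj₂ rw = clash (rest-clique w z′ rw r′) w≁z′

    -- All neighbours of `z` are adjacent to the six vertices of `rest`, hence to each other. The
    -- closed neighbourhood of `z` would be a clique of 26 vertices.
    rest-empty : ∀ z → rest z ≡ false
    rest-empty z with rest z in r
    ... | false = refl
    ... | true  = contradiction (≤-trans (≤-reflexive (sym (degree (proj₁ (rest-elim r))))) (clique≤20 (c z) N-clique))
                                (from-no (26 ≤? 20))
      where
      N-clique : Clique (c z)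
      N-clique u w zu zw = complete-to-six rest
        (≤-trans (six-in-rest r) (#-mono λ w h → proj₂ (∧-elim {c z w} h)))
        (λ a ra → neighbour-complete r ra zu) (λ a ra → neighbour-complete r ra zw) (c-W zu) (c-W zw)

    cover′ : ∀ w → (W w ⇒ C 0F w ∨ C 1F w ∨ C 2F w ∨ C 3F w) ≡ true
    cover′ w with W w | C 0F w | C 1F w | C 2F w | C 3F w | rest-empty w
    ... | false | _     | _     | _     | _     | _ = refl
    ... | true  | true  | _     | _     | _     | _ = refl
    ... | true  | false | true  | _     | _     | _ = refl
    ... | true  | false | false | true  | _     | _ = refl
    ... | true  | false | false | false | true  | _ = refl

    sizes : ∀ {r₀ r₁ r₂ r₃} → # (C 0F) ≤ r₀ → # (C 1F) ≤ r₁ → # (C 2F) ≤ r₂ → # (C 3F) ≤ r₃ →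
            80 ≤ r₀ + (r₁ + (r₂ + (r₃ + 0)))
    sizes b₀ b₁ b₂ b₃ = compare (W ∷ C 0F ∷ C 1F ∷ C 2F ∷ C 3F ∷ [])
      (λ { (w ∷ a ∷ b ∷ d ∷ e ∷ []) → (w ⇒ a ∨ b ∨ d ∨ e)
         , w ∷ []
         , a ∷ b ∷ d ∷ e ∷ [] })
      refl cover′ (≤-reflexive (sym order) ∷ []) (b₀ ∷ b₁ ∷ b₂ ∷ b₃ ∷ [])

    C≤20 : ∀ i → # (C i) ≤ 20
    C≤20 i = clique≤20 (C i) (C-clique i)

    -- Four cliques of at most 20 vertices cover 80, so each has exactly 20.
    twenty : ∀ i → 20 ≤ # (C i)
    twenty 0F = +-cancelʳ-≤ 60 20 (# (C 0F)) (sizes ≤-refl (C≤20 1F) (C≤20 2F) (C≤20 3F))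
    twenty 1F = +-cancelʳ-≤ 40 20 (# (C 1F)) (+-cancelˡ-≤ 20 _ (# (C 1F) + 40) (sizes (C≤20 0F) ≤-refl (C≤20 2F) (C≤20 3F)))
    twenty 2F = +-cancelʳ-≤ 20 20 (# (C 2F)) (+-cancelˡ-≤ 40 _ (# (C 2F) + 20) (sizes (C≤20 0F) (C≤20 1F) ≤-refl (C≤20 3F)))
    twenty 3F = +-cancelʳ-≤ 0 20 (# (C 3F)) (+-cancelˡ-≤ 60 _ (# (C 3F) + 0) (sizes (C≤20 0F) (C≤20 1F) (C≤20 2F) ≤-refl))

  in-20-clique : ∀ {y} → W y ≡ true → ∃[ A ] (Clique A × A y ≡ true × # A ≡ 20)
  in-20-clique {y} Wy = pick (⇒-elim (cover′ V y) Wy)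
    where
    V = proj₂ 4-coclique
    the : ∀ i → C V i y ≡ true → ∃[ A ] (Clique A × A y ≡ true × # A ≡ 20)
    the i h = C V i , C-clique V i , h , ≤-antisym (C≤20 V i) (twenty V i)
    pick : C V 0F y ∨ C V 1F y ∨ C V 2F y ∨ C V 3F y ≡ true → ∃[ A ] (Clique A × A y ≡ true × # A ≡ 20)
    pick h with ∨-elim h
    ... | inj₁ h₀ = the 0F h₀
    ... | inj₂ h with ∨-elim h
    ... | inj₁ h₁ = the 1F h₁
    ... | inj₂ h with ∨-elim h
    ... | inj₁ h₂ = the 2F h₂
    ... | inj₂ h₃ = the 3F h₃

-- Singletons, tight sums and moments

_≡ᵇ_ : ∀ {n} → Fin n → Pred n
u ≡ᵇ w = does (u ≟ w)

≡ᵇ-refl : ∀ {n} (u : Fin n) → (u ≡ᵇ u) ≡ true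
≡ᵇ-refl u = dec-true (u ≟ u) refl

≡ᵇ-sound : ∀ {n} {u w : Fin n} → (u ≡ᵇ w) ≡ true → u ≡ w
≡ᵇ-sound {u = u} {w} = does-true (u ≟ w)

≢ᵇ : ∀ {n} {u w : Fin n} → u ≢ w → (u ≡ᵇ w) ≡ false
≢ᵇ {u = u} {w} = dec-false (u ≟ w)

sum-single : ∀ {n} (u : Fin n) (f : Fin n → ℕ) → sum (λ w → ⟦ u ≡ᵇ w ⟧ * f w) ≡ f u
sum-single {suc n} zero f = begin
  1 * f zero + sum {n} (λ _ → 0)  ≡⟨ cong₂ _+_ (*-identityˡ (f zero)) (zeros n) ⟩
  f zero + 0                      ≡⟨ +-identityʳ (f zero) ⟩
  f zero                          ∎
  where
  open ≡-Reasoning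
  zeros : ∀ n → sum {n} (λ _ → 0) ≡ 0
  zeros zero    = refl
  zeros (suc n) = zeros n
sum-single {suc n} (suc u) f = sum-single u (f ∘ suc)

#-single : ∀ {n} (u : Fin n) → # (u ≡ᵇ_) ≡ 1
#-single u = trans (#-sum (u ≡ᵇ_)) (trans (sum-cong-≗ (λ w → sym (*-identityʳ ⟦ u ≡ᵇ w ⟧))) (sum-single u (λ _ → 1)))

sum-tight : ∀ {n} (f g : Fin n → ℕ) → (∀ i → f i ≤ g i) → sum g ≤ sum f → ∀ i → f i ≡ g i
sum-tight {suc n} f g f≤g g≤f zero = ≤-antisym (f≤g zero)
  (+-cancelʳ-≤ (sum (f ∘ suc)) (g zero) (f zero)
    (≤-trans (+-monoʳ-≤ (g zero) (sum-mono (f ∘ suc) (g ∘ suc) (f≤g ∘ suc))) g≤f))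
sum-tight {suc n} f g f≤g g≤f (suc i) = sum-tight (f ∘ suc) (g ∘ suc) (f≤g ∘ suc)
  (+-cancelˡ-≤ (f zero) (sum (g ∘ suc)) (sum (f ∘ suc))
    (≤-trans (+-monoˡ-≤ (sum (g ∘ suc)) (f≤g zero)) g≤f)) i

module Moments {n : ℕ} (R : Fin n → Pred n) (L : Pred n) where

  degreeIn : Fin n → ℕ
  degreeIn w = # (λ y → R y w ∧ L y)

  weighted : (g : Fin n → ℕ) → sum (λ w → degreeIn w * g w) ≡ ∑⟨ L ⟩ (λ y → ∑⟨ R y ⟩ g)
  weighted g = begin
    sum (λ w → degreeIn w * g w)
      ≡⟨ sum-cong-≗ (λ w → trans (cong (_* g w) (#-sum (λ y → R y w ∧ L y))) (*-distribʳ-sum (g w) (λ y → ⟦ R y w ∧ L y ⟧))) ⟩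
    sum (λ w → sum (λ y → ⟦ R y w ∧ L y ⟧ * g w))
      ≡⟨ ∑-comm (λ w y → ⟦ R y w ∧ L y ⟧ * g w) ⟩
    sum (λ y → sum (λ w → ⟦ R y w ∧ L y ⟧ * g w))
      ≡⟨ sum-cong-≗ (λ y → trans (sum-cong-≗ (λ w → regroup (R y w) (L y) (g w)))
                                 (sym (*-distribˡ-sum ⟦ L y ⟧ (λ w → ⟦ R y w ⟧ * g w)))) ⟩
    ∑⟨ L ⟩ (λ y → ∑⟨ R y ⟩ g) ∎
    where
    open ≡-Reasoning
    regroup : ∀ a b k → ⟦ a ∧ b ⟧ * k ≡ ⟦ b ⟧ * (⟦ a ⟧ * k)
    regroup true  true  k = sym (*-identityˡ (1 * k))
    regroup true  false k = refl
    regroup false true  k = refl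
    regroup false false k = refl

  first-moment : ∀ {a} → (∀ y → L y ≡ true → # (R y) ≡ a) → sum degreeIn ≡ # L * a
  first-moment {a} h = begin
    sum degreeIn                       ≡⟨ sum-cong-≗ (λ w → sym (*-identityʳ (degreeIn w))) ⟩
    sum (λ w → degreeIn w * 1)         ≡⟨ weighted (λ _ → 1) ⟩
    ∑⟨ L ⟩ (λ y → ∑⟨ R y ⟩ (λ _ → 1))  ≡⟨ ∑⟨⟩-cong L (λ y Ly → trans (∑⟨⟩-const (R y) 1) (trans (*-identityʳ (# (R y))) (h y Ly))) ⟩
    ∑⟨ L ⟩ (λ _ → a)                   ≡⟨ ∑⟨⟩-const L a ⟩
    # L * a                            ∎
    where open ≡-Reasoning

  -- The square counts pairs `y`, `z` in `L` related to `w`. Writing the diagonal value as `b + a`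
  -- lets every pair contribute `a`, with a correction `b` when `y = z`.
  second-moment : ∀ {a b} → (∀ y → L y ≡ true → # (R y) ≡ b + a) →
                  (∀ y z → L y ≡ true → L z ≡ true → y ≢ z → # (λ w → R z w ∧ R y w) ≡ a) →
                  sum (λ w → degreeIn w * degreeIn w) ≡ # L * (# L * a + b)
  second-moment {a} {b} diagonal off-diagonal = begin
    sum (λ w → degreeIn w * degreeIn w)
      ≡⟨ weighted degreeIn ⟩
    ∑⟨ L ⟩ (λ y → ∑⟨ R y ⟩ degreeIn)
      ≡⟨ ∑⟨⟩-cong L (λ y _ → double-count (λ w z → R z w) (R y) L) ⟩
    ∑⟨ L ⟩ (λ y → ∑⟨ L ⟩ (λ z → # (λ w → R z w ∧ R y w)))
      ≡⟨ ∑⟨⟩-cong L row ⟩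
    ∑⟨ L ⟩ (λ _ → # L * a + b)
      ≡⟨ ∑⟨⟩-const L (# L * a + b) ⟩
    # L * (# L * a + b) ∎
    where
    open ≡-Reasoning
    entry : ∀ y → L y ≡ true → ∀ z → L z ≡ true → # (λ w → R z w ∧ R y w) ≡ a + ⟦ y ≡ᵇ z ⟧ * b
    entry y Ly z Lz with y ≟ z
    ... | yes refl = trans (#-cong (λ w → idem (R y w))) (trans (diagonal y Ly) (trans (+-comm b a) (cong (a +_) (sym (*-identityˡ b)))))
      where
      idem : ∀ x → x ∧ x ≡ x
      idem true  = refl
      idem false = refl
    ... | no y≢z   = trans (off-diagonal y z Ly Lz y≢z) (sym (+-identityʳ a))
    point : ∀ y → L y ≡ true → ∑⟨ L ⟩ (λ z → ⟦ y ≡ᵇ z ⟧ * b) ≡ b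
    point y Ly = begin
      sum (λ z → ⟦ L z ⟧ * (⟦ y ≡ᵇ z ⟧ * b))  ≡⟨ sum-cong-≗ (λ z → exchange ⟦ L z ⟧ ⟦ y ≡ᵇ z ⟧ b) ⟩
      sum (λ z → ⟦ y ≡ᵇ z ⟧ * (⟦ L z ⟧ * b))  ≡⟨ sum-single y (λ z → ⟦ L z ⟧ * b) ⟩
      ⟦ L y ⟧ * b                              ≡⟨ cong (λ x → ⟦ x ⟧ * b) Ly ⟩
      1 * b                                    ≡⟨ *-identityˡ b ⟩
      b                                        ∎
      where
      exchange : ∀ p q r → p * (q * r) ≡ q * (p * r)
      exchange p q r = trans (sym (*-assoc p q r)) (trans (cong (_* r) (*-comm p q)) (*-assoc q p r))
    row : ∀ y → L y ≡ true → ∑⟨ L ⟩ (λ z → # (λ w → R z w ∧ R y w)) ≡ # L * a + b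
    row y Ly = begin
      ∑⟨ L ⟩ (λ z → # (λ w → R z w ∧ R y w))                  ≡⟨ ∑⟨⟩-cong L (entry y Ly) ⟩
      ∑⟨ L ⟩ (λ z → a + ⟦ y ≡ᵇ z ⟧ * b)                       ≡⟨ ∑⟨⟩-distrib-+ L (λ _ → a) (λ z → ⟦ y ≡ᵇ z ⟧ * b) ⟩
      ∑⟨ L ⟩ (λ _ → a) + ∑⟨ L ⟩ (λ z → ⟦ y ≡ᵇ z ⟧ * b)        ≡⟨ cong₂ _+_ (∑⟨⟩-const L a) (point y Ly) ⟩
      # L * a + b                                              ∎

-- Here far x y stands for d(x , y) = 3.
record Parameters (n : ℕ) : Set where
  field
    adj        : Fin n → Pred n
    far        : Fin n → Pred n
    adj-sym    : ∀ x y → adj x y ≡ adj y x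
    adj-irrefl : ∀ x → adj x x ≡ false
    far-irrefl : ∀ x → far x x ≡ false
    near       : ∀ {x y} → adj x y ≡ true → far x y ≡ false
    near₂      : ∀ {x y z} → adj x y ≡ true → adj y z ≡ true → far x z ≡ false
    vertices   : n ≡ 945
    valency    : ∀ x → # (adj x) ≡ 80
    far-count  : ∀ x → # (far x) ≡ 144
    triangles  : ∀ {x y} → adj x y ≡ true → # (λ w → adj x w ∧ adj y w) ≡ 25
    far-common : ∀ {x y} → adj x y ≡ true → # (λ w → far x w ∧ far y w) ≡ 36
    μ-bound    : ∀ {x y z} → x ≢ y → adj x y ≡ false → adj x z ≡ true → adj y z ≡ true →
                 # (λ w → adj x w ∧ adj y w) ≤ 6

-- The Delsarte type bound on cliques

square≥ : ∀ t → 24 * t ≤ 36 + 4 * (t * t)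
square≥ 0 = z≤n
square≥ 1 = from-yes (24 ≤? 40)
square≥ 2 = from-yes (48 ≤? 52)
-- With `t = 3 + m` the difference of the two sides is `4 * (m * m)`.
square≥ (suc (suc (suc m))) = ≤-trans (m≤m+n (24 * (3 + m)) (4 * (m * m))) (≤-reflexive
  (solve 1 (λ m → con 24 :* (con 3 :+ m) :+ con 4 :* (m :* m) := con 36 :+ con 4 :* ((con 3 :+ m) :* (con 3 :+ m))) refl m))
  where open +-*-Solver

square-tight : ∀ t → 24 * t ≡ 36 + 4 * (t * t) → t ≡ 3
square-tight 0 ()
square-tight 1 ()
square-tight 2 ()
square-tight (suc (suc (suc zero)))    _ = refl
square-tight (suc (suc (suc (suc m)))) h = contradiction
  (+-cancelˡ-≡ (24 * (4 + m)) (suc (3 + 4 * (m * m + 2 * m))) 0 (trans (sym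
    (trans h (solve 1 (λ m → con 36 :+ con 4 :* ((con 4 :+ m) :* (con 4 :+ m))
                           := con 24 :* (con 4 :+ m) :+ (con 4 :+ con 4 :* (m :* m :+ con 2 :* m))) refl m)))
    (sym (+-identityʳ _)))) (λ ())
  where open +-*-Solver

square′≥ : ∀ r → 12 * r ≤ 36 + r * r
square′≥ 0 = z≤n
square′≥ 1 = from-yes (12 ≤? 37)
square′≥ 2 = from-yes (24 ≤? 40)
square′≥ 3 = from-yes (36 ≤? 45)
square′≥ 4 = from-yes (48 ≤? 52)
square′≥ 5 = from-yes (60 ≤? 61)
square′≥ (suc (suc (suc (suc (suc (suc m)))))) = ≤-trans (m≤m+n (12 * (6 + m)) (m * m)) (≤-reflexive
  (solve 1 (λ m → con 12 :* (con 6 :+ m) :+ m :* m := con 36 :+ (con 6 :+ m) :* (con 6 :+ m)) refl m))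
  where open +-*-Solver

sum-const : ∀ n a → sum {n} (λ _ → a) ≡ n * a
sum-const zero    a = refl
sum-const (suc n) a = cong (a +_) (sum-const n a)

#-empty : ∀ {n} {p : Pred n} → (∀ i → p i ≡ false) → # p ≡ 0
#-empty {n} {p} h = trans (#-sum p) (trans (sum-cong-≗ (λ i → cong ⟦_⟧ (h i))) (trans (sum-const n 0) (*-zeroʳ n)))

#-disjoint : ∀ {n} {p q s : Pred n} → (∀ i → ⟦ p i ⟧ ≡ ⟦ q i ⟧ + ⟦ s i ⟧) → # p ≡ # q + # s
#-disjoint {p = p} {q} {s} h = begin
  # p                                          ≡⟨ #-sum p ⟩
  sum (⟦_⟧ ∘ p)                                ≡⟨ sum-cong-≗ h ⟩
  sum (λ i → ⟦ q i ⟧ + ⟦ s i ⟧)                ≡⟨ ∑-distrib-+ (⟦_⟧ ∘ q) (⟦_⟧ ∘ s) ⟩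
  sum (⟦_⟧ ∘ q) + sum (⟦_⟧ ∘ s)                ≡⟨ sym (cong₂ _+_ (#-sum q) (#-sum s)) ⟩
  # q + # s                                    ∎
  where open ≡-Reasoning

-- The sums of `lhs` and `rhs` below over all vertices, for a clique of `l` vertices.
totals : ℕ → ℕ → ℕ × ℕ
totals n l = let k = l ∸ 1 in
    (24 * (l * 80) + 12 * (l * 144)) + l * (36 + 4 * (k * k))
  , (n * 36 + (4 * (l * (l * 25 + 55)) + l * (l * 36 + 108))) + l * (24 * k)

too-large : ∀ {n l} → n ≡ 945 → l < 82 → 22 ≤ l → ¬ proj₁ (totals n l) ≤ proj₂ (totals n l)
too-large refl = from-yes (allUpTo? (λ l → 22 ≤? l →-dec ¬? (proj₁ (totals 945 l) ≤? proj₂ (totals 945 l))) 82)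

totals-21 : ∀ {n l} → n ≡ 945 → l ≡ 21 → proj₂ (totals n l) ≡ proj₁ (totals n l)
totals-21 refl refl = refl

module Cliques {n : ℕ} (G : Parameters n) where
  open Parameters G public

  IsClique : Pred n → Set
  IsClique L = ∀ a b → L a ≡ true → L b ≡ true → a ≢ b → adj a b ≡ true

  module _ {L : Pred n} (clique : IsClique L) where

    private
      module T = Moments adj L
      module R = Moments far L
      t = T.degreeIn
      r = R.degreeIn

    t-inside : ∀ {w} → L w ≡ true → # L ≡ suc (t w)
    t-inside {w} Lw = trans (#-disjoint split) (cong (_+ t w) (#-single w))
      where
      split : ∀ y → ⟦ L y ⟧ ≡ ⟦ w ≡ᵇ y ⟧ + ⟦ adj y w ∧ L y ⟧
      split y with w ≟ y
      ... | yes refl = trans (cong ⟦_⟧ Lw) (cong (λ b → suc ⟦ b ∧ L w ⟧) (sym (adj-irrefl w)))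
      ... | no w≢y with L y in Ly
      ...   | true  = cong (λ b → ⟦ b ∧ true ⟧) (sym (clique y w Ly Lw (w≢y ∘ sym)))
      ...   | false = cong ⟦_⟧ (sym (∧-zeroʳ (adj y w)))

    r-empty : ∀ {w} → (∀ y → L y ≡ true → far y w ≡ false) → r w ≡ 0
    r-empty {w} h = #-empty λ y → none y
      where
      none : ∀ y → far y w ∧ L y ≡ false
      none y with L y in Ly
      ... | true  = cong (_∧ true) (h y Ly)
      ... | false = ∧-zeroʳ (far y w)

    r-inside : ∀ {w} → L w ≡ true → r w ≡ 0
    r-inside {w} Lw = r-empty near-L
      where
      near-L : ∀ y → L y ≡ true → far y w ≡ false
      near-L y Ly with y ≟ w
      ... | yes refl = far-irrefl y
      ... | no y≢w   = near (clique y w Ly Lw y≢w)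

    r-adjacent : ∀ {w y} → adj y w ≡ true → L y ≡ true → r w ≡ 0
    r-adjacent {w} {y} yw Ly = r-empty near-L
      where
      near-L : ∀ z → L z ≡ true → far z w ≡ false
      near-L z Lz with z ≟ y
      ... | yes refl = near yw
      ... | no z≢y   = near₂ (clique z y Lz Ly z≢y) yw

    -- A vertex with a neighbour in the clique is at distance at most 2 from every member.
    t-or-r : ∀ w → t w ≡ 0 ⊎ r w ≡ 0
    t-or-r w with 1 ≤? t w
    ... | no ¬1≤t = inj₁ (n≤0⇒n≡0 (s≤s⁻¹ (≰⇒> ¬1≤t)))
    ... | yes 1≤t with y , h ← member (λ y → adj y w ∧ L y) 1≤t =
      inj₂ (r-adjacent (proj₁ (∧-elim h)) (proj₂ (∧-elim {adj y w} h)))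

    module _ {k : ℕ} (size : # L ≡ suc k) where

      -- Off `L` the difference of `rhs` and `lhs` is the square of `2t + r - 6`, because `t` and
      -- `r` are not both positive. On `L`, where `t = k` and `r = 0`, the terms with `L w` make the
      -- two sides equal.
      lhs rhs : Fin n → ℕ
      lhs w = (24 * t w + 12 * r w) + ⟦ L w ⟧ * (36 + 4 * (k * k))
      rhs w = (36 + (4 * (t w * t w) + r w * r w)) + ⟦ L w ⟧ * (24 * k)

      -- Off L this says (t - 3)² ≥ 0 or (r - 6)² ≥ 0, since t and r are not both positive.
      lhs≤rhs : ∀ w → lhs w ≤ rhs w
      lhs≤rhs w with L w in Lw
      ... | true  = inside (suc-injective (trans (sym (t-inside Lw)) size)) (r-inside Lw)
        where
        inside : ∀ {t r} → t ≡ k → r ≡ 0 →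
                 (24 * t + 12 * r) + 1 * (36 + 4 * (k * k)) ≤ (36 + (4 * (t * t) + r * r)) + 1 * (24 * k)
        inside refl refl = ≤-reflexive (solve 1 (λ k →
          (con 24 :* k :+ con 12 :* con 0) :+ con 1 :* (con 36 :+ con 4 :* (k :* k))
          := (con 36 :+ (con 4 :* (k :* k) :+ con 0 :* con 0)) :+ con 1 :* (con 24 :* k)) refl k)
          where open +-*-Solver
      ... | false = +-monoˡ-≤ 0 (outside (t-or-r w))
        where
        outside : ∀ {t r} → t ≡ 0 ⊎ r ≡ 0 → 24 * t + 12 * r ≤ 36 + (4 * (t * t) + r * r)
        outside {r = r} (inj₁ refl) = square′≥ r
        outside {t = t} (inj₂ refl) = subst₂ _≤_ (sym (+-identityʳ (24 * t)))
          (cong (36 +_) (sym (+-identityʳ (4 * (t * t))))) (square≥ t)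

      sum-lhs : sum lhs ≡ (24 * (# L * 80) + 12 * (# L * 144)) + # L * (36 + 4 * (k * k))
      sum-lhs = trans (∑-distrib-+ (λ w → 24 * t w + 12 * r w) (λ w → ⟦ L w ⟧ * (36 + 4 * (k * k))))
        (cong₂ _+_
          (trans (∑-distrib-+ (λ w → 24 * t w) (λ w → 12 * r w))
            (cong₂ _+_
              (trans (sym (*-distribˡ-sum 24 t)) (cong (24 *_) (T.first-moment (λ y _ → valency y))))
              (trans (sym (*-distribˡ-sum 12 r)) (cong (12 *_) (R.first-moment (λ y _ → far-count y))))))
          (∑⟨⟩-const L (36 + 4 * (k * k))))

      sum-rhs : sum rhs ≡ (n * 36 + (4 * (# L * (# L * 25 + 55)) + # L * (# L * 36 + 108))) + # L * (24 * k)
      sum-rhs = trans (∑-distrib-+ (λ w → 36 + (4 * (t w * t w) + r w * r w)) (λ w → ⟦ L w ⟧ * (24 * k)))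
        (cong₂ _+_
          (trans (∑-distrib-+ (λ _ → 36) (λ w → 4 * (t w * t w) + r w * r w))
            (cong₂ _+_ (sum-const n 36)
              (trans (∑-distrib-+ (λ w → 4 * (t w * t w)) (λ w → r w * r w))
                (cong₂ _+_
                  (trans (sym (*-distribˡ-sum 4 (λ w → t w * t w))) (cong (4 *_)
                    (T.second-moment (λ y _ → valency y) (λ y z Ly Lz y≢z → triangles (clique z y Lz Ly (y≢z ∘ sym))))))
                  (R.second-moment (λ y _ → far-count y) (λ y z Ly Lz y≢z → far-common (clique z y Lz Ly (y≢z ∘ sym))))))))
          (∑⟨⟩-const L (24 * k)))

    -- A clique lies in the closed neighbourhood of each member, so it has at most 81 vertices. The
    -- summed inequality fails for every size from 22 to 81.
    clique≤21 : # L ≤ 21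
    clique≤21 with # L ≤? 21
    ... | yes h = h
    ... | no ¬h = ⊥-elim (contradict (≰⇒> ¬h))
      where
      contradict : ¬ 22 ≤ # L
      contradict 22≤L with w , Lw ← member L (≤-trans (s≤s z≤n) 22≤L) =
        too-large vertices (s≤s (≤-trans (≤-reflexive (t-inside Lw)) (s≤s (≤-trans (#-mono λ y h → trans (adj-sym w y) (proj₁ (∧-elim h)))
                                                                (≤-reflexive (valency w)))))) 22≤L
          (subst (λ k → (24 * (# L * 80) + 12 * (# L * 144)) + # L * (36 + 4 * (k * k))
                      ≤ (n * 36 + (4 * (# L * (# L * 25 + 55)) + # L * (# L * 36 + 108))) + # L * (24 * k))
                 (cong (_∸ 1) (sym (t-inside Lw)))
            (subst₂ _≤_ (sum-lhs (t-inside Lw)) (sum-rhs (t-inside Lw))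
              (sum-mono (lhs (t-inside Lw)) (rhs (t-inside Lw)) (lhs≤rhs (t-inside Lw)))))

    -- For size 21 the two sums agree, so `lhs` and `rhs` agree at every vertex. As `w` has a
    -- neighbour on `L`, `r` vanishes there, and what remains is `(t - 3)² = 0`.
    three-neighbours : # L ≡ 21 → ∀ {w y} → L w ≡ false → adj y w ≡ true → L y ≡ true → t w ≡ 3
    three-neighbours size {w} {y} Lw yw Ly = off (r-adjacent yw Ly) tight
      where
      numbers : (n * 36 + (4 * (# L * (# L * 25 + 55)) + # L * (# L * 36 + 108))) + # L * (24 * 20)
              ≡ (24 * (# L * 80) + 12 * (# L * 144)) + # L * (36 + 4 * (20 * 20))
      numbers = subst (λ k → (n * 36 + (4 * (# L * (# L * 25 + 55)) + # L * (# L * 36 + 108))) + # L * (24 * k)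
                           ≡ (24 * (# L * 80) + 12 * (# L * 144)) + # L * (36 + 4 * (k * k)))
                      (cong (_∸ 1) size) (totals-21 vertices size)
      total : sum (rhs size) ≤ sum (lhs size)
      total = ≤-reflexive (trans (sum-rhs size) (trans numbers (sym (sum-lhs size))))
      tight : (24 * t w + 12 * r w) + 0 ≡ (36 + (4 * (t w * t w) + r w * r w)) + 0
      tight = subst (λ b → (24 * t w + 12 * r w) + ⟦ b ⟧ * (36 + 4 * (20 * 20))
                         ≡ (36 + (4 * (t w * t w) + r w * r w)) + ⟦ b ⟧ * (24 * 20)) Lw
        (sum-tight (lhs size) (rhs size) (lhs≤rhs size) total w)
      off : ∀ {t r} → r ≡ 0 → (24 * t + 12 * r) + 0 ≡ (36 + (4 * (t * t) + r * r)) + 0 → t ≡ 3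
      off {t} refl h = square-tight t (begin
        24 * t                            ≡⟨ solve 1 (λ t → con 24 :* t := (con 24 :* t :+ con 12 :* con 0) :+ con 0) refl t ⟩
        (24 * t + 12 * 0) + 0             ≡⟨ h ⟩
        (36 + (4 * (t * t) + 0 * 0)) + 0  ≡⟨ solve 1 (λ t → (con 36 :+ (con 4 :* (t :* t) :+ con 0 :* con 0)) :+ con 0 := con 36 :+ con 4 :* (t :* t)) refl t ⟩
        36 + 4 * (t * t)                  ∎)
        where
        open ≡-Reasoning
        open +-*-Solver

-- Lines of size 21 and the final contradiction

module Geometry {n : ℕ} (G : Parameters n) where
  open Cliques G

  near-in : Fin n → Fin n → Pred n
  near-in x u w = adj x u ∧ adj x w ∧ (adj u w ∨ (u ≡ᵇ w))

  private
    near-in-u : ∀ {x u} → adj x u ≡ true → ∀ w → near-in x u w ≡ adj x w ∧ (adj u w ∨ (u ≡ᵇ w))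
    near-in-u {x} {u} xu w = cong (_∧ (adj x w ∧ (adj u w ∨ (u ≡ᵇ w)))) xu

  local : Fin n → Local n
  local x = record
    { W      = adj x
    ; c      = near-in x
    ; c-refl = λ {u} xu → ∧-intro xu (∧-intro xu (trans (cong (adj u u ∨_) (≡ᵇ-refl u)) (∨-zeroʳ (adj u u))))
    ; c-sym  = near-sym
    ; c-W    = λ {u} h → proj₁ (∧-elim (proj₂ (∧-elim {adj x u} h)))
    ; order  = valency x
    ; degree = near-degree
    ; common = near-common
    }
    where
    ≡ᵇ-sym : ∀ u w → (u ≡ᵇ w) ≡ (w ≡ᵇ u)
    ≡ᵇ-sym u w = ⇔-≡ (λ h → trans (cong (w ≡ᵇ_) (≡ᵇ-sound h)) (≡ᵇ-refl w))
                     (λ h → trans (cong (u ≡ᵇ_) (≡ᵇ-sound h)) (≡ᵇ-refl u))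
    near-sym : ∀ u w → near-in x u w ≡ near-in x w u
    near-sym u w rewrite adj-sym u w | ≡ᵇ-sym u w with adj x u | adj x w
    ... | true  | true  = refl
    ... | true  | false = refl
    ... | false | true  = refl
    ... | false | false = refl
    near-degree : ∀ {u} → adj x u ≡ true → # (near-in x u) ≡ 26
    near-degree {u} xu = trans (#-disjoint split) (cong₂ _+_ (triangles xu) (#-single u))
      where
      split : ∀ w → ⟦ near-in x u w ⟧ ≡ ⟦ adj x w ∧ adj u w ⟧ + ⟦ u ≡ᵇ w ⟧
      split w rewrite near-in-u xu w with u ≟ w
      ... | yes refl rewrite xu | adj-irrefl u = refl
      ... | no _ with adj x w | adj u w
      ...   | true  | true  = refl
      ...   | true  | false = refl
      ...   | false | _     = refl
    -- Of the at most 6 common neighbours in the whole graph, one is `x` itself.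
    near-common : ∀ {u w} → adj x u ≡ true → adj x w ≡ true → near-in x u w ≡ false →
                  # (λ z → near-in x u z ∧ near-in x w z) ≤ 5
    near-common {u} {w} xu xw u≁w = s≤s⁻¹ (subst (_≤ 6) (+-comm _ 1)
      (compare (adj x ∷ adj u ∷ adj w ∷ (u ≡ᵇ_) ∷ (w ≡ᵇ_) ∷ (x ≡ᵇ_) ∷ near-in x u ∷ near-in x w ∷ [])
        (λ { (ax ∷ au ∷ aw ∷ eu ∷ ew ∷ ex ∷ nu ∷ nw ∷ []) → table ax au aw eu ew ex nu nw
           , (nu ∧ nw) ∷ ex ∷ [] , (au ∧ aw) ∷ [] })
        refl hyp (≤-refl ∷ ≤-reflexive (sym (#-single x)) ∷ []) (μ-bound u≢w u≁w′ (trans (adj-sym u x) xu) (trans (adj-sym w x) xw) ∷ [])))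
      where
      u≁w∨ : adj u w ∨ (u ≡ᵇ w) ≡ false
      u≁w∨ = trans (sym (cong₂ (λ a b → a ∧ b ∧ (adj u w ∨ (u ≡ᵇ w))) xu xw)) u≁w
      u≁w′ : adj u w ≡ false
      u≁w′ = proj₁ (∨-false u≁w∨)
      u≢w : u ≢ w
      u≢w refl = clash (≡ᵇ-refl u) (proj₂ (∨-false u≁w∨))
      table : (ax au aw eu ew ex nu nw : Bool) → Bool
      table ax au aw eu ew ex nu nw = (nu ⇒ ax ∧ (au ∨ eu)) ∧ (nw ⇒ ax ∧ (aw ∨ ew))
        ∧ (eu ⇒ not ew ∧ not aw) ∧ (ew ⇒ not au) ∧ (ex ⇒ not ax ∧ au ∧ aw)
      hyp : ∀ z → table (adj x z) (adj u z) (adj w z) (u ≡ᵇ z) (w ≡ᵇ z) (x ≡ᵇ z) (near-in x u z) (near-in x w z) ≡ true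
      hyp z = ∧-intro (⇒-intro λ h → proj₂ (∧-elim {adj x u} h)) (∧-intro (⇒-intro λ h → proj₂ (∧-elim {adj x w} h))
        (∧-intro (⇒-intro λ eu → at-u (≡ᵇ-sound eu)) (∧-intro (⇒-intro λ ew → at-w (≡ᵇ-sound ew)) (⇒-intro λ ex → at-x (≡ᵇ-sound ex)))))
        where
        at-u : u ≡ z → not (w ≡ᵇ z) ∧ not (adj w z) ≡ true
        at-u refl = ∧-intro (not-intro (≢ᵇ (u≢w ∘ sym))) (not-intro (trans (adj-sym w u) u≁w′))
        at-w : w ≡ z → not (adj u z) ≡ true
        at-w refl = not-intro u≁w′
        at-x : x ≡ z → not (adj x z) ∧ adj u z ∧ adj w z ≡ true
        at-x refl = ∧-intro (not-intro (adj-irrefl x)) (∧-intro (trans (adj-sym u x) xu) (trans (adj-sym w x) xw))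

  cone : Fin n → Pred n → Pred n
  cone x A w = (x ≡ᵇ w) ∨ A w

  module _ (x : Fin n) {A : Pred n} (clique : LocalTheory.Clique (local x) A) where

    A⊆adj : ∀ {a} → A a ≡ true → adj x a ≡ true
    A⊆adj {a} Aa = proj₁ (∧-elim (clique a a Aa Aa))

    cone-clique : IsClique (cone x A)
    cone-clique a b ha hb a≢b with ∨-elim {x ≡ᵇ a} ha | ∨-elim {x ≡ᵇ b} hb
    ... | inj₁ x≡a | inj₁ x≡b = contradiction (trans (sym (≡ᵇ-sound {u = x} x≡a)) (≡ᵇ-sound {u = x} x≡b)) a≢b
    ... | inj₁ x≡a | inj₂ Ab  = subst (λ y → adj y b ≡ true) (≡ᵇ-sound {u = x} x≡a) (A⊆adj Ab)
    ... | inj₂ Aa  | inj₁ x≡b = subst (λ y → adj a y ≡ true) (≡ᵇ-sound {u = x} x≡b) (trans (adj-sym a x) (A⊆adj Aa))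
    ... | inj₂ Aa  | inj₂ Ab  with ∨-elim (proj₂ (∧-elim {adj x b} (proj₂ (∧-elim {adj x a} (clique a b Aa Ab)))))
    ...   | inj₁ ab  = ab
    ...   | inj₂ a≡b = contradiction (≡ᵇ-sound a≡b) a≢b

    cone-size : # (cone x A) ≡ suc (# A)
    cone-size = trans (#-disjoint split) (cong (_+ # A) (#-single x))
      where
      split : ∀ w → ⟦ cone x A w ⟧ ≡ ⟦ x ≡ᵇ w ⟧ + ⟦ A w ⟧
      split w with x ≟ w | A w in Aw
      ... | yes refl | true  = clash (A⊆adj Aw) (adj-irrefl x)
      ... | yes refl | false = refl
      ... | no _     | _     = refl

  record Line (L : Pred n) : Set where
    field
      clique : IsClique L
      size   : # L ≡ 21

  open Line

  -- The 20-clique on `y` in the local graph at `x`, with `x` added. The bound 20 that the partition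
  -- needs is 21 less the vertex `x`.
  line-through : ∀ {x y} → adj x y ≡ true → ∃[ L ] (Line L × L x ≡ true × L y ≡ true)
  line-through {x} {y} xy =
    let A , A-clique , Ay , A-size = FourCliques.in-20-clique (local x) bound xy in
    cone x A
    , record { clique = cone-clique x A-clique ; size = trans (cone-size x A-clique) (cong suc A-size) }
    , trans (cong (_∨ A x) (≡ᵇ-refl x)) refl
    , trans (cong ((x ≡ᵇ y) ∨_) Ay) (∨-zeroʳ (x ≡ᵇ y))
    where
    bound : ∀ A → LocalTheory.Clique (local x) A → # A ≤ 20
    bound A cl = s≤s⁻¹ (≤-trans (≤-reflexive (sym (cone-size x cl))) (clique≤21 (cone-clique x cl)))

  three-on-line : ∀ {L} → Line L → ∀ {p a} → L p ≡ false → L a ≡ true → adj p a ≡ true →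
                  # (λ w → adj p w ∧ L w) ≡ 3
  three-on-line {L} ℓ {p} {a} p∉L La pa = trans (#-cong λ w → cong (_∧ L w) (adj-sym p w))
    (three-neighbours (clique ℓ) (size ℓ) p∉L (trans (adj-sym a p) pa) La)

  -- Two distinct lines with two common points would give these points 37 common neighbours.
  line-unique : ∀ {L M} → Line L → Line M → ∀ {u v} → u ≢ v → L u ≡ true → L v ≡ true → M u ≡ true → M v ≡ true →
                ∀ {p} → L p ≡ true → M p ≡ true
  line-unique {L} {M} ℓ m {u} {v} u≢v Lu Lv Mu Mv {p} Lp with M p in p∉M
  ... | true  = refl
  ... | false = contradiction
    (compare (L ∷ M ∷ adj u ∷ adj v ∷ (u ≡ᵇ_) ∷ (v ≡ᵇ_) ∷ [])
      (λ { (l ∷ m ∷ au ∷ av ∷ eu ∷ ev ∷ []) → (l ∨ m ⇒ (eu ∨ au) ∧ (ev ∨ av))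
         , l ∷ m ∷ []
         , (au ∧ av) ∷ eu ∷ ev ∷ (l ∧ m) ∷ [] })
      refl (λ w → ⇒-intro λ h → hyp w (∨-elim h))
      (≤-reflexive (sym (size ℓ)) ∷ ≤-reflexive (sym (size m)) ∷ [])
      (≤-reflexive (triangles (clique ℓ u v Lu Lv u≢v)) ∷ ≤-reflexive (#-single u) ∷ ≤-reflexive (#-single v) ∷ meet ∷ []))
    (from-no (42 ≤? 30))
    where
    on : ∀ {K} → Line K → ∀ {x} → K x ≡ true → ∀ w → K w ≡ true → (x ≡ᵇ w) ∨ adj x w ≡ true
    on k {x} Kx w Kw with x ≟ w
    ... | yes _   = refl
    ... | no x≢w = clique k x w Kx Kw x≢w
    hyp : ∀ w → L w ≡ true ⊎ M w ≡ true → ((u ≡ᵇ w) ∨ adj u w) ∧ ((v ≡ᵇ w) ∨ adj v w) ≡ true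
    hyp w (inj₁ Lw) = ∧-intro (on ℓ Lu w Lw) (on ℓ Lv w Lw)
    hyp w (inj₂ Mw) = ∧-intro (on m Mu w Mw) (on m Mv w Mw)
    meet : # (λ w → L w ∧ M w) ≤ 3
    meet = ≤-trans (#-mono into) (≤-reflexive (three-on-line m p∉M Mu (clique ℓ p u Lp Lu λ { refl → clash Mu p∉M })))
      where
      into : ∀ w → L w ∧ M w ≡ true → adj p w ∧ M w ≡ true
      into w h = let Lw , Mw = ∧-elim h in ∧-intro (clique ℓ p w Lp Lw λ { refl → clash Mw p∉M }) Mw

  -- The three lines joining x to its neighbours on L each carry three neighbours of y.
  nine : ∀ {L} → Line L → ∀ {x y p₁ p₂ p₃} → L x ≡ false → L y ≡ true → adj x y ≡ false →
         L p₁ ≡ true → L p₂ ≡ true → L p₃ ≡ true → adj x p₁ ≡ true → adj x p₂ ≡ true → adj x p₃ ≡ true →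
         p₁ ≢ p₂ → p₁ ≢ p₃ → p₂ ≢ p₃ →
         ∃[ M ] (Line M × M x ≡ true × M p₁ ≡ true) →
         ∃[ M ] (Line M × M x ≡ true × M p₂ ≡ true) →
         ∃[ M ] (Line M × M x ≡ true × M p₃ ≡ true) → ⊥
  nine {L} ℓ {x} {y} x∉L Ly x≁y Lp₁ Lp₂ Lp₃ xp₁ xp₂ xp₃ p₁≢p₂ p₁≢p₃ p₂≢p₃
    (M₁ , m₁ , M₁x , M₁p) (M₂ , m₂ , M₂x , M₂p) (M₃ , m₃ , M₃x , M₃p) = contradiction
    (compare (M₁ ∷ M₂ ∷ M₃ ∷ adj x ∷ adj y ∷ (x ≡ᵇ_) ∷ [])
      (λ { (a ∷ b ∷ d ∷ ax ∷ ay ∷ ex ∷ []) → table a b d ax ay ex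
         , (ay ∧ a) ∷ (ay ∧ b) ∷ (ay ∧ d) ∷ []
         , (ax ∧ ay) ∷ [] })
      refl hyp
      (three m₁ M₁x M₁p Lp₁ xp₁ ∷ three m₂ M₂x M₂p Lp₂ xp₂ ∷ three m₃ M₃x M₃p Lp₃ xp₃ ∷ [])
      (μ-bound x≢y x≁y xp₁ (adj-y Lp₁ xp₁) ∷ []))
    (from-no (9 ≤? 6))
    where
    x≢y : x ≢ y
    x≢y refl = clash Ly x∉L
    adj-y : ∀ {p} → L p ≡ true → adj x p ≡ true → adj y p ≡ true
    adj-y {p} Lp xp = clique ℓ y p Ly Lp λ { refl → clash xp x≁y }
    three : ∀ {M p} → Line M → M x ≡ true → M p ≡ true → L p ≡ true → adj x p ≡ true → 3 ≤ # (λ w → adj y w ∧ M w)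
    three {M} m Mx Mp Lp xp = ≤-reflexive (sym (three-on-line m y∉M Mp (adj-y Lp xp)))
      where
      y∉M : M y ≡ false
      y∉M = ¬-not λ My → clash (clique m x y Mx My x≢y) x≁y
    -- A second common point would put `p` on `N` as well; then `N` shares `p` and `q` with `L`, and
    -- `x` would lie on `L`.
    meet : ∀ {M N p q} → Line M → Line N → M x ≡ true → N x ≡ true → M p ≡ true → N q ≡ true →
           L p ≡ true → L q ≡ true → p ≢ q → ∀ {w} → M w ∧ N w ≡ true → (x ≡ᵇ w) ≡ true
    meet {M} {N} m k Mx Nx Mp Nq Lp Lq p≢q {w} h with x ≟ w
    ... | yes _  = refl
    ... | no x≢w = let Mw , Nw = ∧-elim h in
      clash (line-unique k ℓ p≢q (line-unique m k x≢w Mx Mw Nx Nw Mp) Nq Lp Lq Nx) x∉L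
    table : (a b d ax ay ex : Bool) → Bool
    table a b d ax ay ex = (a ∨ b ∨ d ⇒ ex ∨ ax) ∧ (ex ⇒ not ay) ∧ (a ∧ b ⇒ ex) ∧ (a ∧ d ⇒ ex) ∧ (b ∧ d ⇒ ex)
    hyp : ∀ w → table (M₁ w) (M₂ w) (M₃ w) (adj x w) (adj y w) (x ≡ᵇ w) ≡ true
    hyp w = ∧-intro (⇒-intro on) (∧-intro (⇒-intro λ h → at-x (≡ᵇ-sound h))
      (∧-intro (⇒-intro (meet m₁ m₂ M₁x M₂x M₁p M₂p Lp₁ Lp₂ p₁≢p₂))
      (∧-intro (⇒-intro (meet m₁ m₃ M₁x M₃x M₁p M₃p Lp₁ Lp₃ p₁≢p₃))
               (⇒-intro (meet m₂ m₃ M₂x M₃x M₂p M₃p Lp₂ Lp₃ p₂≢p₃)))))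
      where
      at-x : x ≡ w → not (adj y w) ≡ true
      at-x refl = not-intro (trans (adj-sym y x) x≁y)
      on-line : ∀ {M} → Line M → M x ≡ true → M w ≡ true → (x ≡ᵇ w) ∨ adj x w ≡ true
      on-line m Mx Mw with x ≟ w
      ... | yes _  = refl
      ... | no x≢w = clique m x w Mx Mw x≢w
      on : M₁ w ∨ M₂ w ∨ M₃ w ≡ true → (x ≡ᵇ w) ∨ adj x w ≡ true
      on h with ∨-elim h
      ... | inj₁ M₁w = on-line m₁ M₁x M₁w
      ... | inj₂ h with ∨-elim h
      ... | inj₁ M₂w = on-line m₂ M₂x M₂w
      ... | inj₂ M₃w = on-line m₃ M₃x M₃w

  three-members : (p : Pred n) → 3 ≤ # p → ∃[ a ] ∃[ b ] ∃[ d ] (p a ≡ true × p b ≡ true × p d ≡ true × a ≢ b × a ≢ d × b ≢ d)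
  three-members p h =
    let a , pa = member p (≤-trans (s≤s z≤n) h)
        b , pb = member (p₁ a) (≤-trans (s≤s z≤n) (remove p a h))
        d , pd = member (λ w → p₁ a w ∧ not (b ≡ᵇ w)) (remove (p₁ a) b (remove p a h))
        pb′ , a≢b = ∧-elim pb
        p₁d , b≢d = ∧-elim pd
        pd′ , a≢d = ∧-elim p₁d
    in a , b , d , pa , pb′ , pd′ , distinct a≢b , distinct a≢d , distinct b≢d
    where
    p₁ : Fin n → Pred n
    p₁ a w = p w ∧ not (a ≡ᵇ w)
    remove : ∀ (p : Pred n) a {k} → suc k ≤ # p → k ≤ # (λ w → p w ∧ not (a ≡ᵇ w))
    remove p a {k} h = +-cancelʳ-≤ 0 k _ (s≤s⁻¹
      (compare (p ∷ (a ≡ᵇ_) ∷ []) (λ { (b ∷ e ∷ []) → true , b ∷ [] , e ∷ (b ∧ not e) ∷ [] })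
        refl (λ _ → refl) (h ∷ []) (≤-reflexive (#-single a) ∷ ≤-refl ∷ [])))
    distinct : ∀ {a b} → not (a ≡ᵇ b) ≡ true → a ≢ b
    distinct {a} h refl = clash (≡ᵇ-refl a) (not-elim h)

  -- A line `L` on `u` cannot hold all 80 neighbours of `u`, which gives `x` off `L` with exactly 3
  -- neighbours on it. Among the other 18 points of `L` there is a `y` for `nine`.
  contradictory : Fin n → ⊥
  contradictory u =
    let v , uv = member (adj u) (≤-trans (s≤s z≤n) (≤-reflexive (sym (valency u))))
        L , ℓ , Lu , Lv = line-through uv
        x , hx = member (λ w → adj u w ∧ not (L w)) (outside ℓ)
        ux , x∉L = ∧-elim hx
        xu = trans (adj-sym x u) ux
        three = three-on-line ℓ (not-elim x∉L) Lu xu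
        y , hy = member (λ w → L w ∧ not (adj x w)) (far-point ℓ three)
        Ly , x≁y = ∧-elim hy
        a , b , d , pa , pb , pd , a≢b , a≢d , b≢d = three-members (λ w → adj x w ∧ L w) (≤-reflexive (sym three))
        xa = proj₁ (∧-elim pa)
        xb = proj₁ (∧-elim pb)
        xd = proj₁ (∧-elim pd)
    in nine ℓ (not-elim x∉L) Ly (not-elim x≁y)
         (proj₂ (∧-elim {adj x a} pa)) (proj₂ (∧-elim {adj x b} pb)) (proj₂ (∧-elim {adj x d} pd))
         xa xb xd a≢b a≢d b≢d (line-through xa) (line-through xb) (line-through xd)
    where
    outside : ∀ {L} → Line L → 1 ≤ # (λ w → adj u w ∧ not (L w))
    outside {L} ℓ = +-cancelʳ-≤ 21 1 _ (≤-trans (m≤m+n 22 58) (compare (adj u ∷ L ∷ [])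
      (λ { (a ∷ l ∷ []) → true , a ∷ [] , (a ∧ not l) ∷ l ∷ [] }) refl (λ _ → refl)
      (≤-reflexive (sym (valency u)) ∷ []) (≤-refl ∷ ≤-reflexive (size ℓ) ∷ [])))
    far-point : ∀ {L x} → Line L → # (λ w → adj x w ∧ L w) ≡ 3 → 1 ≤ # (λ w → L w ∧ not (adj x w))
    far-point {L} {x} ℓ three = +-cancelʳ-≤ 3 1 _ (≤-trans (m≤m+n 4 17) (compare (adj x ∷ L ∷ [])
      (λ { (a ∷ l ∷ []) → true , l ∷ [] , (l ∧ not a) ∷ (a ∧ l) ∷ [] }) refl (λ _ → refl)
      (≤-reflexive (sym (size ℓ)) ∷ []) (≤-refl ∷ ≤-reflexive three ∷ [])))

-- From the intersection array to the parameters

count-# : ∀ {n} {P : Fin n → Set} (P? : ∀ i → Dec (P i)) → count P? (allFin n) ≡ # (λ i → does (P? i))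
count-# {n} P? = trans (tabulated n (λ i → i)) (sym (#-sum (does ∘ P?)))
  where
  tabulated : ∀ m (f : Fin m → Fin n) → count P? (tabulate f) ≡ sum (λ i → ⟦ does (P? (f i)) ⟧)
  tabulated zero    f = refl
  tabulated (suc m) f with does (P? (f zero))
  ... | true  = cong suc (tabulated m (f ∘ suc))
  ... | false = tabulated m (f ∘ suc)

module Distances {n : ℕ} (G : Graph n)
                 (R : IsDistanceRegular G (80 ∷ 54 ∷ 12 ∷ []) (1 ∷ 6 ∷ 60 ∷ [])) where
  open Graph G renaming (sym to Adj-sym)
  open IsDistanceRegular R

  walk-snoc : ∀ k {x y z} → Walk G k x y → Adj y z → Walk G (suc k) x z
  walk-snoc zero    refl         yz = _ , yz , refl
  walk-snoc (suc k) (w , xw , p) yz = w , xw , walk-snoc k p yz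

  walk-sym : ∀ k {x y} → Walk G k x y → Walk G k y x
  walk-sym zero    p            = sym p
  walk-sym (suc k) (w , xw , p) = walk-snoc k (walk-sym k p) (Adj-sym xw)

  Dist-sym : ∀ k {x y} → Dist G k x y → Dist G k y x
  Dist-sym k (p , shortest) = walk-sym k p , λ {j} j<k q → shortest j<k (walk-sym j q)

  Dist-≤ : ∀ {j k x y} → Dist G k x y → Walk G j x y → k ≤ j
  Dist-≤ {j} {k} (_ , shortest) q with k ≤? j
  ... | yes k≤j = k≤j
  ... | no k≰j  = contradiction q (shortest (≰⇒> k≰j))

  Dist-unique : ∀ {j k x y} → Dist G j x y → Dist G k x y → j ≡ k
  Dist-unique p q = ≤-antisym (Dist-≤ p (proj₁ q)) (Dist-≤ q (proj₁ p))

  Dist-step : ∀ {j k x y z} → Adj y z → Dist G j x y → Dist G k x z → k ≤ suc j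
  Dist-step {j} yz p q = Dist-≤ q (walk-snoc j (proj₁ p) yz)

  Dist-0 : ∀ x → Dist G 0 x x
  Dist-0 x = refl , λ ()

  Dist-1 : ∀ {x y} → Adj x y → Dist G 1 x y
  Dist-1 {x} xy = (_ , xy , refl) , λ { {zero} _ refl → irrefl x xy ; {suc _} (s≤s ()) _ }

  Adj-1 : ∀ {x y} → Dist G 1 x y → Adj x y
  Adj-1 ((_ , xz , refl) , _) = xz

  distance : ∀ x y → ∃[ k ] (k ≤ 3 × Dist G k x y)
  distance = proj₁ diameter

  opaque
    a : Fin n → Pred n
    a x y = does (adj? x y)

    d : ℕ → Fin n → Pred n
    d k x y = does (dist? G k x y)

    a-elim : ∀ {x y} → a x y ≡ true → Adj x y
    a-elim {x} {y} = does-true (adj? x y)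

    a-intro : ∀ {x y} → Adj x y → a x y ≡ true
    a-intro {x} {y} = dec-true (adj? x y)

    d-elim : ∀ k {x y} → d k x y ≡ true → Dist G k x y
    d-elim k {x} {y} = does-true (dist? G k x y)

    d-intro : ∀ k {x y} → Dist G k x y → d k x y ≡ true
    d-intro k {x} {y} = dec-true (dist? G k x y)

    d-false : ∀ j {k x y} → Dist G k x y → j ≢ k → d j x y ≡ false
    d-false j {k} {x} {y} p j≢k = dec-false (dist? G j x y) (λ q → j≢k (Dist-unique q p))

    neighbours : ∀ k x y → neighboursAt G k x y ≡ # (λ z → a y z ∧ d k x z)
    neighbours k x y = count-# (λ z → adj? y z ×-dec dist? G k x z)

  a-sym : ∀ x y → a x y ≡ a y x
  a-sym x y = ⇔-≡ (a-intro ∘ Adj-sym ∘ a-elim) (a-intro ∘ Adj-sym ∘ a-elim)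

  d₁ : ∀ x y → d 1 x y ≡ a x y
  d₁ x y = ⇔-≡ (a-intro ∘ Adj-1 ∘ d-elim 1) (d-intro 1 ∘ Dist-1 ∘ a-elim)

  valency : ∀ x → # (a x) ≡ 80
  valency x = trans (#-cong λ z → sym (trans (cong (a x z ∧_) (d₁ x z)) (∧-idem (a x z))))
                    (trans (sym (neighbours 1 x x)) (b-number 0F x x (Dist-0 x)))

  b₁ : ∀ {x y} → a x y ≡ true → # (λ z → a y z ∧ d 2 x z) ≡ 54
  b₁ {x} {y} xy = trans (sym (neighbours 2 x y)) (b-number 1F x y (Dist-1 (a-elim xy)))

  b₂ : ∀ {x y} → d 2 x y ≡ true → # (λ z → a y z ∧ d 3 x z) ≡ 12
  b₂ {x} {y} xy = trans (sym (neighbours 3 x y)) (b-number 2F x y (d-elim 2 xy))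

  c₁ : ∀ {x y} → a x y ≡ true → # (λ z → a y z ∧ d 0 x z) ≡ 1
  c₁ {x} {y} xy = trans (sym (neighbours 0 x y)) (c-number 0F x y (Dist-1 (a-elim xy)))

  c₂ : ∀ {x y} → d 2 x y ≡ true → # (λ z → a y z ∧ a x z) ≡ 6
  c₂ {x} {y} xy = trans (#-cong λ z → cong (a y z ∧_) (sym (d₁ x z)))
    (trans (sym (neighbours 1 x y)) (c-number 1F x y (d-elim 2 xy)))

  c₃ : ∀ {x y} → d 3 x y ≡ true → # (λ z → a y z ∧ d 2 x z) ≡ 60
  c₃ {x} {y} xy = trans (sym (neighbours 2 x y)) (c-number 2F x y (d-elim 3 xy))

  -- By the diameter, every vertex is at exactly one of the distances 0, 1, 2, 3 from `x`.
  classes : ∀ x (p : Pred n) → # p ≡ # (λ z → p z ∧ d 0 x z) + (# (λ z → p z ∧ d 1 x z)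
              + (# (λ z → p z ∧ d 2 x z) + # (λ z → p z ∧ d 3 x z)))
  classes x p = begin
    # p                                                 ≡⟨ #-sum p ⟩
    sum (⟦_⟧ ∘ p)                                       ≡⟨ sum-cong-≗ (λ z → by z (distance x z)) ⟩
    sum (λ z → f 0 z + (f 1 z + (f 2 z + f 3 z)))       ≡⟨ ∑-distrib-+ (f 0) (λ z → f 1 z + (f 2 z + f 3 z)) ⟩
    sum (f 0) + sum (λ z → f 1 z + (f 2 z + f 3 z))     ≡⟨ cong (sum (f 0) +_) (∑-distrib-+ (f 1) (λ z → f 2 z + f 3 z)) ⟩
    sum (f 0) + (sum (f 1) + sum (λ z → f 2 z + f 3 z)) ≡⟨ cong (λ s → sum (f 0) + (sum (f 1) + s)) (∑-distrib-+ (f 2) (f 3)) ⟩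
    sum (f 0) + (sum (f 1) + (sum (f 2) + sum (f 3)))   ≡⟨ sym (cong₂ _+_ (c 0) (cong₂ _+_ (c 1) (cong₂ _+_ (c 2) (c 3)))) ⟩
    # (λ z → p z ∧ d 0 x z) + (# (λ z → p z ∧ d 1 x z) + (# (λ z → p z ∧ d 2 x z) + # (λ z → p z ∧ d 3 x z))) ∎
    where
    open ≡-Reasoning
    f : ℕ → Fin n → ℕ
    f k z = ⟦ p z ∧ d k x z ⟧
    c : ∀ k → # (λ z → p z ∧ d k x z) ≡ sum (f k)
    c k = #-sum (λ z → p z ∧ d k x z)
    split : ∀ b {d₀ d₁ d₂ d₃} → trues (d₀ ∷ d₁ ∷ d₂ ∷ d₃ ∷ []) ≡ 1 →
            ⟦ b ⟧ ≡ ⟦ b ∧ d₀ ⟧ + (⟦ b ∧ d₁ ⟧ + (⟦ b ∧ d₂ ⟧ + ⟦ b ∧ d₃ ⟧))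
    split false h = refl
    split true {d₀} {d₁} {d₂} {d₃} h = trans (sym h)
      (cong (λ s → ⟦ d₀ ⟧ + (⟦ d₁ ⟧ + (⟦ d₂ ⟧ + s))) (+-identityʳ ⟦ d₃ ⟧))
    by : ∀ z → ∃[ k ] (k ≤ 3 × Dist G k x z) → ⟦ p z ⟧ ≡ f 0 z + (f 1 z + (f 2 z + f 3 z))
    by z (k , k≤3 , D) = split (p z) (one k k≤3 D)
      where
      one : ∀ k → k ≤ 3 → Dist G k x z → trues (d 0 x z ∷ d 1 x z ∷ d 2 x z ∷ d 3 x z ∷ []) ≡ 1
      one 0 _ D rewrite d-intro 0 D | d-false 1 D (λ ()) | d-false 2 D (λ ()) | d-false 3 D (λ ()) = refl
      one 1 _ D rewrite d-intro 1 D | d-false 0 D (λ ()) | d-false 2 D (λ ()) | d-false 3 D (λ ()) = refl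
      one 2 _ D rewrite d-intro 2 D | d-false 0 D (λ ()) | d-false 1 D (λ ()) | d-false 3 D (λ ()) = refl
      one 3 _ D rewrite d-intro 3 D | d-false 0 D (λ ()) | d-false 1 D (λ ()) | d-false 2 D (λ ()) = refl
      one (suc (suc (suc (suc k)))) (s≤s (s≤s (s≤s ()))) D

  ∧-false : ∀ {p q : Pred n} → (∀ z → p z ≡ true → q z ≡ false) → # (λ z → p z ∧ q z) ≡ 0
  ∧-false {p} {q} h = #-empty λ z → none z
    where
    none : ∀ z → p z ∧ q z ≡ false
    none z with p z in pz
    ... | true  = h z pz
    ... | false = refl

  -- The intersection number a₁ = 80 - 54 - 1; no neighbour of `y` is at distance 3 from `x`.
  triangles : ∀ {x y} → a x y ≡ true → # (λ z → a x z ∧ a y z) ≡ 25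
  triangles {x} {y} xy = trans (#-cong λ z → trans (∧-comm (a x z) (a y z)) (cong (a y z ∧_) (sym (d₁ x z))))
    (+-cancelʳ-≡ 54 _ 25 (suc-injective (begin
      1 + (N 1 + 54)                  ≡⟨ cong₂ (λ u v → u + (N 1 + v)) (sym (c₁ xy)) (trans (sym (+-identityʳ 54)) (cong₂ _+_ (sym (b₁ xy)) (sym far-none))) ⟩
      N 0 + (N 1 + (N 2 + N 3))       ≡⟨ sym (classes x (a y)) ⟩
      # (a y)                         ≡⟨ valency y ⟩
      80                              ∎)))
    where
    open ≡-Reasoning
    N : ℕ → ℕ
    N k = # (λ z → a y z ∧ d k x z)
    far-none : N 3 ≡ 0
    far-none = ∧-false λ z yz → ¬-not λ h →
      contradiction (Dist-step (a-elim yz) (Dist-1 (a-elim xy)) (d-elim 3 h)) (from-no (3 ≤? 2))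

  -- Double counting of the edges between `p` and `q`. Between consecutive distance classes it gives
  -- 80 · 54 = 720 · 6 and 720 · 12 = 144 · 60.
  layer : ∀ (p q : Pred n) {j k} → (∀ y → p y ≡ true → # (λ z → a y z ∧ q z) ≡ j) →
          (∀ z → q z ≡ true → # (λ y → a z y ∧ p y) ≡ k) → # p * j ≡ # q * k
  layer p q {j} {k} out back = begin
    # p * j                              ≡⟨ sym (∑⟨⟩-const p j) ⟩
    ∑⟨ p ⟩ (λ _ → j)                     ≡⟨ sym (∑⟨⟩-cong p out) ⟩
    ∑⟨ p ⟩ (λ y → # (λ z → a y z ∧ q z)) ≡⟨ double-count a p q ⟩
    ∑⟨ q ⟩ (λ z → # (λ y → a y z ∧ p y)) ≡⟨ ∑⟨⟩-cong q (λ z qz → trans (#-cong λ y → cong (_∧ p y) (a-sym y z)) (back z qz)) ⟩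
    ∑⟨ q ⟩ (λ _ → k)                     ≡⟨ ∑⟨⟩-const q k ⟩
    # q * k                              ∎
    where open ≡-Reasoning

  k₂ : ∀ x → # (d 2 x) ≡ 720
  k₂ x = *-cancelʳ-≡ _ 720 6 (trans (sym (layer (a x) (d 2 x) (λ y → b₁) (λ z → c₂))) (cong (_* 54) {y = 80} (valency x)))

  k₃ : ∀ x → # (d 3 x) ≡ 144
  k₃ x = *-cancelʳ-≡ _ 144 60 (trans (sym (layer (d 2 x) (d 3 x) (λ y → b₂) (λ z → c₃))) (cong (_* 12) {y = 720} (k₂ x)))

  vertices : Fin n → n ≡ 945
  vertices x = begin
    n                                        ≡⟨ sym (*-identityʳ n) ⟩
    n * 1                                    ≡⟨ sym (sum-const n 1) ⟩
    sum {n} (λ _ → 1)                        ≡⟨ sym (#-sum (λ _ → true)) ⟩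
    # (λ _ → true)                           ≡⟨ classes x (λ _ → true) ⟩
    # (d 0 x) + (# (d 1 x) + (# (d 2 x) + # (d 3 x)))
      ≡⟨ cong₂ _+_ k₀ (cong₂ _+_ (trans (#-cong (d₁ x)) (valency x)) (cong₂ _+_ (k₂ x) (k₃ x))) ⟩
    945                                      ∎
    where
    open ≡-Reasoning
    k₀ : # (d 0 x) ≡ 1
    k₀ = trans (#-cong λ z → ⇔-≡ (λ h → trans (cong (x ≡ᵇ_) (sym (proj₁ (d-elim 0 h)))) (≡ᵇ-refl x))
                                 (λ h → subst (λ y → d 0 x y ≡ true) (≡ᵇ-sound h) (d-intro 0 (Dist-0 x))))
               (#-single x)

  -- Counting the pairs u ~ w with u at distance 1 from x and 2 from y and w at distance 3 from y.
  p₂₃ : ∀ {x y} → a x y ≡ true → # (λ w → d 3 y w ∧ d 2 x w) ≡ 108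
  p₂₃ {x} {y} xy = *-cancelʳ-≡ _ 108 6 (begin
    # (λ w → d 3 y w ∧ d 2 x w) * 6
      ≡⟨ sym (layer (λ u → a x u ∧ d 2 y u) (λ w → d 3 y w ∧ d 2 x w) out back) ⟩
    # (λ u → a x u ∧ d 2 y u) * 12
      ≡⟨ cong (_* 12) {y = 54} (b₁ (trans (a-sym y x) xy)) ⟩
    648 ∎)
    where
    open ≡-Reasoning
    yx : Adj y x
    yx = Adj-sym (a-elim xy)
    out : ∀ u → a x u ∧ d 2 y u ≡ true → # (λ w → a u w ∧ (d 3 y w ∧ d 2 x w)) ≡ 12
    out u h = let xu , yu = ∧-elim h in trans (#-cong λ w → ⇔-≡
        (λ h → let uw , h′ = ∧-elim {a u w} h in ∧-intro uw (proj₁ (∧-elim h′)))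
        (λ h → let uw , yw = ∧-elim {a u w} h in ∧-intro uw (∧-intro yw (two xu uw (d-elim 3 yw) (distance x w)))))
      (b₂ yu)
      where
      two : ∀ {w} → a x u ≡ true → a u w ≡ true → Dist G 3 y w → ∃[ k ] (k ≤ 3 × Dist G k x w) → d 2 x w ≡ true
      two {w} xu uw yw (k , _ , xw) = subst (λ k → d k x w ≡ true)
        (≤-antisym (Dist-step (a-elim uw) (Dist-1 (a-elim xu)) xw)
          (s≤s⁻¹ (Dist-step (Adj-sym yx) (Dist-sym k xw) (Dist-sym 3 yw)))) (d-intro k xw)
    back : ∀ w → d 3 y w ∧ d 2 x w ≡ true → # (λ u → a w u ∧ (a x u ∧ d 2 y u)) ≡ 6
    back w h = let yw , xw = ∧-elim h in trans (#-cong λ u → ⇔-≡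
        (λ h → let wu , h′ = ∧-elim {a w u} h in ∧-intro wu (proj₁ (∧-elim h′)))
        (λ h → let wu , xu = ∧-elim {a w u} h in ∧-intro wu (∧-intro xu (two xu wu (d-elim 3 yw) (distance y u)))))
      (c₂ xw)
      where
      two : ∀ {u} → a x u ≡ true → a w u ≡ true → Dist G 3 y w → ∃[ k ] (k ≤ 3 × Dist G k y u) → d 2 y u ≡ true
      two {u} xu wu yw (k , _ , yu) = subst (λ k → d k y u ≡ true)
        (≤-antisym (Dist-step (a-elim xu) (Dist-1 yx) yu)
          (s≤s⁻¹ (Dist-step (Adj-sym (a-elim wu)) yu yw))) (d-intro k yu)

  -- Of the 144 vertices at distance 3 from `y`, none is within distance 1 of `x` and 108 are at
  -- distance 2, which leaves 36.
  far-common : ∀ {x y} → a x y ≡ true → # (λ w → d 3 x w ∧ d 3 y w) ≡ 36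
  far-common {x} {y} xy = trans (#-cong λ w → ∧-comm (d 3 x w) (d 3 y w)) (+-cancelˡ-≡ 108 _ 36 (begin
    108 + N 3                    ≡⟨ cong₂ _+_ {x = 0} (sym zeros) (cong (_+ N 3) {x = 108} (sym (p₂₃ xy))) ⟩
    (N 0 + N 1) + (N 2 + N 3)    ≡⟨ +-assoc (N 0) (N 1) (N 2 + N 3) ⟩
    N 0 + (N 1 + (N 2 + N 3))    ≡⟨ sym (classes x (d 3 y)) ⟩
    # (d 3 y)                    ≡⟨ k₃ y ⟩
    144                          ∎))
    where
    open ≡-Reasoning
    N : ℕ → ℕ
    N k = # (λ w → d 3 y w ∧ d k x w)
    none : ∀ k → k ≤ 1 → N k ≡ 0
    none k k≤1 = ∧-false λ w yw → ¬-not λ xw →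
      contradiction (≤-trans (Dist-step (a-elim xy) (Dist-sym k (d-elim k xw)) (Dist-sym 3 (d-elim 3 yw))) (s≤s k≤1))
                    (from-no (3 ≤? 2))
    zeros : N 0 + N 1 ≡ 0
    zeros = cong₂ _+_ (none 0 z≤n) (none 1 ≤-refl)

  -- The common neighbour `z` places the two vertices at distance 2, where c₂ = 6 applies.
  μ : ∀ {x y z} → x ≢ y → a x y ≡ false → a x z ≡ true → a y z ≡ true → # (λ w → a x w ∧ a y w) ≤ 6
  μ {x} {y} {z} x≢y x≁y xz yz = ≤-reflexive (trans (#-cong λ w → ∧-comm (a x w) (a y w)) (c₂ (at-two (distance x y))))
    where
    at-two : ∃[ k ] (k ≤ 3 × Dist G k x y) → d 2 x y ≡ true
    at-two (0 , _ , D) = contradiction (proj₁ D) x≢y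
    at-two (1 , _ , D) = clash (a-intro (Adj-1 D)) x≁y
    at-two (2 , _ , D) = d-intro 2 D
    at-two (suc (suc (suc k)) , _ , D) = contradiction
      (Dist-step (Adj-sym (a-elim yz)) (Dist-1 (a-elim xz)) D) λ { (s≤s (s≤s ())) }

  -- A vertex is needed to count all vertices around it; the diameter condition supplies one.
  parameters : Fin n → Parameters n
  parameters x₀ = record
    { adj        = a
    ; far        = d 3
    ; adj-sym    = a-sym
    ; adj-irrefl = λ x → ¬-not λ h → irrefl x (a-elim h)
    ; far-irrefl = λ x → d-false 3 (Dist-0 x) λ ()
    ; near       = λ h → d-false 3 (Dist-1 (a-elim h)) λ ()
    ; near₂      = λ xy yz → ¬-not λ h →
        contradiction (Dist-step (a-elim yz) (Dist-1 (a-elim xy)) (d-elim 3 h)) (from-no (3 ≤? 2))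
    ; vertices   = vertices x₀
    ; valency    = valency
    ; far-count  = k₃
    ; triangles  = triangles
    ; far-common = far-common
    ; μ-bound    = μ
    }

theorem5p6 : ¬ (∃[ n ] Σ[ G ∈ Graph n ]
    IsDistanceRegular G (80 ∷ 54 ∷ 12 ∷ []) (1 ∷ 6 ∷ 60 ∷ []))
theorem5p6 (n , G , R) =
  let x₀ = proj₁ (proj₂ (IsDistanceRegular.diameter R))
  in Geometry.contradictory (Distances.parameters G R x₀) x₀
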